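{- Let $k\ge 3$ be an integer. (a) There exists a constant $c_k>0$ such that with probability tending to $1$ as $n\to\infty$, $f^*(k,2,n)\ge (c_k+\tfrac12)n$. (b) There is a function $\varepsilon(n)\to 0$ such that with probability tending to $1$ as $n\to\infty$, $$\frac{f^*(k,n)}{n}-\varepsilon(n)\le\begin{cases}\frac12+\frac{1}{4\cdot 3^{k/3-1}} & \text{if } k\equiv 0 \pmod 3,\\ \frac12+\frac{1}{2\cdot 3^{(k-1)/3}} & \text{if } k\equiv 1 \pmod 3,\\ \frac12+\frac{1}{8\cdot 3^{(k-5)/3}} & \text{if } k\equiv 2 \pmod 3.\end{cases}$$
   Context: A tournament is an orientation of a complete graph. An arborescence is an oriented tree with a designated root such that every vertex of the tree is reachable from the root by a directed path in the tree; its depth is the length of a longest directed path in it. An edge-colored arborescence is path-monochromatic if every directed path in it is monochromatic. A $k$-edge coloring is an arbitrary assignment of one of $k$ colors to each edge. For a tournament $T$, $f_T(k,\ell)$ is the largest integer $m$ such that every $k$-edge coloring of $T$ contains a path-monochromatic arborescence of depth at most $\ell$ with at least $m$ vertices, and $f_T(k)$ is the same without depth restriction. A random tournament $T\sim\mathcal T_n$ is the tournament on vertex set $[n]$ where each edge is oriented independently by a fair coin flip. $f^*(k,\ell,n)$ and $f^*(k,n)$ denote the random variables $f_T(k,\ell)$ and $f_T(k)$ for $T\sim\mathcal T_n$. -}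

module Defs where

open import Data.Bool using (Bool; true; false)
open import Data.Nat as ℕ using (ℕ; zero; suc; _∸_; _^_; _%_)
open import Data.Nat.Properties using (m*n≢0; m^n≢0)
open import Data.Nat.Combinatorics using (_C_)
open import Data.Integer using (+_)
open import Data.Rational as ℚ using (ℚ; _/_; ½; 0ℚ; 1ℚ)
open import Data.Fin using (Fin)
open import Data.Fin.Subset using (Subset; _∈_; ∣_∣)
open import Data.List using (List; length)
open import Data.List.Relation.Unary.All using (All)
open import Data.List.Relation.Unary.AllPairs using (AllPairs)
open import Data.Product using (Σ; ∃; ∃-syntax; _×_)
open import Relation.Binary.PropositionalEquality using (_≡_; _≢_)
open import Relation.Nullary using (¬_)

ℚ[_] : ℕ → ℚ
ℚ[ n ] = + n / 1

record Tournament (n : ℕ) : Set where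
  field
    arc       : Fin n → Fin n → Bool
    irrefl    : ∀ i → arc i i ≡ false
    oneWay    : ∀ i j → arc i j ≡ true → arc j i ≡ false
    total     : ∀ i j → i ≢ j → arc i j ≡ false → arc j i ≡ true
open Tournament public

Distinct : ∀ {n} → Tournament n → Tournament n → Set
Distinct T U = ∃[ i ] ∃[ j ] arc T i j ≢ arc U i j

-- A k-edge coloring: every (ordered) pair gets a color; only the values
-- on arcs of T are used.
Coloring : ℕ → ℕ → Set
Coloring n k = Fin n → Fin n → Fin k

-- Arborescences in T, given by vertex set S, root r, parent map and
-- depth labels: every non-root vertex v ∈ S has its parent in S, the
-- arc parent v → v is in T, and depth v = depth (parent v) + 1, with
-- depth r = 0 (so depth v is the length of the tree path r ⇝ v).

record Arborescence {n} (T : Tournament n) : Set where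
  field
    vertices : Subset n
    root     : Fin n
    parent   : Fin n → Fin n
    depth    : Fin n → ℕ
    root∈    : root ∈ vertices
    rootDepth : depth root ≡ 0
    parent∈  : ∀ v → v ∈ vertices → v ≢ root → parent v ∈ vertices
    parentArc : ∀ v → v ∈ vertices → v ≢ root → arc T (parent v) v ≡ true
    parentDepth : ∀ v → v ∈ vertices → v ≢ root → depth v ≡ suc (depth (parent v))
open Arborescence public

size : ∀ {n} {T : Tournament n} → Arborescence T → ℕ
size A = ∣ vertices A ∣

-- depth (longest directed path, all start at the root) at most ℓ
DepthAtMost : ∀ {n} {T : Tournament n} → ℕ → Arborescence T → Set
DepthAtMost ℓ A = ∀ v → v ∈ vertices A → depth A v ℕ.≤ ℓ

-- path-monochromatic: every directed path is monochromatic; in a tree a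
-- directed path is a chain of consecutive parent arcs, so this says that
-- any two consecutive arcs  parent p → p → v  have the same color.
PathMonochromatic : ∀ {n k} {T : Tournament n} → Coloring n k → Arborescence T → Set
PathMonochromatic c A =
  ∀ v → v ∈ vertices A → v ≢ root A → parent A v ≢ root A →
    c (parent A v) v ≡ c (parent A (parent A v)) (parent A v)

-- "f_T(k,ℓ) ≥ m": every k-coloring of T has a path-monochromatic
-- arborescence of depth ≤ ℓ with at least m vertices.
-- (f_T(k,ℓ) is the largest m with this property; the property is
-- downward closed in m.)

HasPMA : ∀ {n} → Tournament n → (k ℓ m : ℕ) → Set
HasPMA {n} T k ℓ m = (c : Coloring n k) →
  ∃[ A ] (PathMonochromatic {T = T} c A × DepthAtMost ℓ A × m ℕ.≤ size A)

HasPMA∞ : ∀ {n} → Tournament n → (k m : ℕ) → Set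
HasPMA∞ {n} T k m = (c : Coloring n k) →
  ∃[ A ] (PathMonochromatic {T = T} c A × m ℕ.≤ size A)

-- "With probability tending to 1 as n → ∞" for T ∼ 𝒯ₙ (uniform over the
-- 2^(n choose 2) tournaments on [n]): for every δ > 0 there is N such that
-- for all n ≥ N at least (1 - δ)·2^(n C 2) distinct tournaments on [n]
-- satisfy P n.

WHP : (P : (n : ℕ) → Tournament n → Set) → Set
WHP P = (δ : ℚ) → 0ℚ ℚ.< δ → ∃[ N ] ∀ n → N ℕ.≤ n →
  ∃[ L ] (AllPairs Distinct L × All (P n) L ×
          (1ℚ ℚ.- δ) ℚ.* ℚ[ 2 ^ (n C 2) ] ℚ.≤ ℚ[ length {A = Tournament n} L ])

-- The bound in part (b), with q = ⌊k/3⌋: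
--   k ≡ 0: 1/2 + 1/(4·3^(q-1))     (k/3 - 1 = q - 1)
--   k ≡ 1: 1/2 + 1/(2·3^q)         ((k-1)/3 = q)
--   k ≡ 2: 1/2 + 1/(8·3^(q-1))     ((k-5)/3 = q - 1)

inv : (a j : ℕ) → .{{ℕ.NonZero a}} → ℚ
inv a j {{nz}} = _/_ (+ 1) (a ℕ.* 3 ^ j) {{m*n≢0 a (3 ^ j) {{nz}} {{m^n≢0 3 j}}}}

boundCase : ℕ → ℕ → ℚ
boundCase 0 q = ½ ℚ.+ inv 4 (q ∸ 1)
boundCase 1 q = ½ ℚ.+ inv 2 q
boundCase _ q = ½ ℚ.+ inv 8 (q ∸ 1)

bound : ℕ → ℚ
bound k = boundCase (k % 3) (k ℕ./ 3)

{-# OPTIONS --safe #-}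
-- Part (a).  For k colors, a density argument over the 2^k possible sets of
-- "frequent incoming colors" yields a vertex v and a color i with linearly many
-- incoming and linearly many outgoing arcs of color i, leading from I and to O.
-- In a random tournament a constant fraction of the pairs between any two large
-- disjoint sets is oriented from O to I, so some r ∈ I has linearly many
-- in-neighbours in O.  The tree r → N⁺(r), r → v → O then has depth two and
-- exceeds n/2 by a linear amount.
--
-- Part (b).  Split the vertices into t equal parts, where t is the largest product
-- of positive integers with sum k − 1.  Arcs inside parts share one color, and the
-- other k − 1 colors can be placed on the arcs between parts so that no two
-- consecutive ones have the same color.  A path-monochromatic arborescence with
-- root r is then contained in N⁺(r) together with the part of r, which has about
-- n/2 + n/(2t) vertices.
--
-- The required concentration is a Chernoff bound: give each pair of vertices the
-- weight q ± 1 or q according to whether its arc agrees with, contradicts or is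
-- irrelevant to the event.  The weights of all tournaments add up to (2q)^(n C 2),
-- while a tournament in the event has a weight exponentially larger than q^(n C 2).
module Submission where

open import Defs
open import Data.Nat using (ℕ; _≤_)
open import Data.Product using (Σ; ∃-syntax; _×_)
open import Data.Nat as ℕ using (zero; suc; z≤n; s≤s; NonZero)
import Data.Nat.Properties as ℕₚ
open import Data.Nat.Combinatorics using (_C_)
import Data.Nat.DivMod as DivMod
open import Data.Nat.Tactic.RingSolver using (solve-∀)
open import Data.List as List using (List; []; _∷_; length)
open import Data.List.Relation.Unary.All as All using (All; []; _∷_)
open import Data.Product using (_,_; proj₁; proj₂)
open import Data.Sum as Sum using (_⊎_; inj₁; inj₂)
open import Relation.Nullary using (¬_; Dec; yes; no; does; contradiction; _×-dec_)
open import Relation.Binary.PropositionalEquality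

-- Finite combinatorics, with probabilities as counts of tournaments.

module Counting where

  open import Data.Nat hiding (_≟_)
  open import Data.Nat.Properties hiding (_≟_)
  open import Data.Nat.Combinatorics using (nC1≡n; nCk+nC[k+1]≡[n+1]C[k+1])
  open import Data.Nat.DivMod using (m≡m%n+[m/n]*n; m%n<n; m/n*n≤m; m*n/n≡m; /-monoˡ-≤)
  import Data.Nat.ListAction as ListAction
  open import Algebra.Properties.Semiring.Sum +-*-semiring using (sum; sum-cong-≗; ∑-distrib-+; ∑-comm; *-distribˡ-sum; *-distribʳ-sum; sum-replicate-zero)
  open import Data.Bool using (Bool; true; false; not; _∧_; _∨_; if_then_else_; T)
  open import Data.Bool.Properties as Boolₚ using (∧-zeroʳ; ∧-identityʳ; ∨-zeroʳ)
  open import Data.Fin using (Fin; zero; suc; splitAt; remQuot; combine; inject≤; _↑ˡ_; _↑ʳ_)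
  open import Data.Fin.Properties as Finₚ using (all?; any?; ¬∀⟶∃¬; splitAt-↑ˡ; splitAt-↑ʳ; ↑ˡ-injective; ↑ʳ-injective; combine-remQuot)
  open import Data.Fin.Subset as Subset using (Subset; _∈_)
  open import Data.List using (_++_; allFin; filter; map; cartesianProductWith)
  open import Data.List.Properties using (length-map; length-tabulate)
  import Data.List.Membership.Propositional as List
  open import Data.List.Membership.Propositional.Properties using (∈-allFin; ∈-map⁺; ∈-cartesianProductWith⁺)
  import Data.List.Relation.Unary.All.Properties as Allₚ
  open import Data.List.Relation.Unary.AllPairs as AllPairs using (AllPairs; []; _∷_)
  import Data.List.Relation.Unary.AllPairs.Properties as AllPairsₚ
  open import Data.List.Relation.Unary.Any using (here; there)
  open import Data.List.Relation.Unary.Unique.Propositional using (Unique)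
  import Data.List.Relation.Unary.Unique.Propositional.Properties as Uniqueₚ
  open import Data.Vec using (Vec; []; _∷_; lookup; tabulate)
  open import Data.Vec.Properties using ([]=⇒lookup; lookup⇒[]=; lookup∘tabulate)
  open import Function using (_∘_; Equivalence)
  open import Relation.Nullary.Decidable using (dec-true; dec-false)
  open import Relation.Unary using (Decidable)

  -- An exponential tilt

  ^-distribʳ-* : ∀ n x y → (x * y) ^ n ≡ x ^ n * y ^ n
  ^-distribʳ-* zero    x y = refl
  ^-distribʳ-* (suc n) x y = trans (cong (x * y *_) (^-distribʳ-* n x y)) (swap x y (x ^ n) (y ^ n))
    where
    swap : ∀ a b c d → a * b * (c * d) ≡ a * c * (b * d)
    swap = solve-∀

  -- Bernoulli's inequality (1 + 1/v)^m ≥ 1 + m/v without denominators.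
  bernoulli-suc : ∀ v m → v ^ m * (v + m) ≤ v * suc v ^ m
  bernoulli-suc v zero = ≤-reflexive (solve v)
    where
    solve : ∀ v → 1 * (v + 0) ≡ v * 1
    solve = solve-∀
  bernoulli-suc v (suc m) = begin
    v * v ^ m * (v + suc m)             ≤⟨ m≤m+n _ (v ^ m * m) ⟩
    v * v ^ m * (v + suc m) + v ^ m * m ≡⟨ lhs v m (v ^ m) ⟩
    suc v * (v ^ m * (v + m))           ≤⟨ *-monoʳ-≤ (suc v) (bernoulli-suc v m) ⟩
    suc v * (v * suc v ^ m)             ≡⟨ rhs v (suc v ^ m) ⟩
    v * (suc v * suc v ^ m)             ∎
    where
    open ≤-Reasoning
    lhs : ∀ v m x → v * x * (v + suc m) + x * m ≡ suc v * (x * (v + m))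
    lhs = solve-∀
    rhs : ∀ v x → suc v * (v * x) ≡ v * (suc v * x)
    rhs = solve-∀

  -- Bernoulli's inequality (1 - 1/(s+1))^m ≥ 1 - m/(s+1) without denominators, the negative term
  -- moved across.
  bernoulli-pred : ∀ s m → suc s ^ m * suc s ≤ s ^ m * suc s + m * suc s ^ m
  bernoulli-pred s zero = ≤-reflexive (sym (+-identityʳ _))
  bernoulli-pred s (suc m) = begin
    suc s * suc s ^ m * suc s
      ≡⟨ *-assoc (suc s) (suc s ^ m) (suc s) ⟩
    suc s * (suc s ^ m * suc s)
      ≤⟨ *-monoʳ-≤ (suc s) (bernoulli-pred s m) ⟩
    suc s * (s ^ m * suc s + m * suc s ^ m)
      ≡⟨ expand s m (s ^ m) (suc s ^ m) ⟩
    s * s ^ m * suc s + (s ^ m * suc s + m * (suc s * suc s ^ m))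
      ≤⟨ +-monoʳ-≤ (s * s ^ m * suc s) (+-monoˡ-≤ (m * (suc s * suc s ^ m)) (*-monoˡ-≤ (suc s) (^-monoˡ-≤ m (n≤1+n s)))) ⟩
    s * s ^ m * suc s + (suc s ^ m * suc s + m * (suc s * suc s ^ m))
      ≡⟨ collect s m (s ^ m) (suc s ^ m) ⟩
    s * s ^ m * suc s + suc m * (suc s * suc s ^ m) ∎
    where
    open ≤-Reasoning
    expand : ∀ s m x y → suc s * (x * suc s + m * y) ≡ s * x * suc s + (x * suc s + m * (suc s * y))
    expand = solve-∀
    collect : ∀ s m x y → s * x * suc s + (y * suc s + m * (suc s * y)) ≡ s * x * suc s + suc m * (suc s * y)
    collect = solve-∀

  doubling : ∀ v .{{_ : NonZero v}} → 2 * v ^ v ≤ suc v ^ v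
  doubling v = *-cancelˡ-≤ v (begin
    v * (2 * v ^ v)   ≡⟨ swap v (v ^ v) ⟩
    v ^ v * (v + v)   ≤⟨ bernoulli-suc v v ⟩
    v * suc v ^ v     ∎)
    where
    open ≤-Reasoning
    swap : ∀ v x → v * (2 * x) ≡ x * (v + v)
    swap = solve-∀

  -- The exponent `D` contains `K` blocks of length `v`. Each block gains (1 + 1/v)^v ≥ 2 by
  -- `doubling`, and the remaining `r` factors lose nothing.
  exponential-growth : ∀ {u v} .{{_ : NonZero v}} K D → v < u → v * K ≤ D → 2 ^ K * v ^ D ≤ u ^ D
  exponential-growth {u} {v} K D v<u vK≤D = begin
    2 ^ K * v ^ D                  ≡⟨ cong (λ z → 2 ^ K * v ^ z) (sym D≡) ⟩
    2 ^ K * v ^ (v * K + r)        ≡⟨ cong (2 ^ K *_) (trans (^-distribˡ-+-* v (v * K) r) (cong (_* v ^ r) (sym (^-*-assoc v v K)))) ⟩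
    2 ^ K * ((v ^ v) ^ K * v ^ r)  ≡⟨ sym (*-assoc (2 ^ K) _ _) ⟩
    2 ^ K * (v ^ v) ^ K * v ^ r    ≡⟨ cong (_* v ^ r) (sym (^-distribʳ-* K 2 (v ^ v))) ⟩
    (2 * v ^ v) ^ K * v ^ r        ≤⟨ *-mono-≤ (^-monoˡ-≤ K (≤-trans (doubling v) (^-monoˡ-≤ v v<u))) (^-monoˡ-≤ r (<⇒≤ v<u)) ⟩
    (u ^ v) ^ K * u ^ r            ≡⟨ cong (_* u ^ r) (^-*-assoc u v K) ⟩
    u ^ (v * K) * u ^ r            ≡⟨ sym (^-distribˡ-+-* u (v * K) r) ⟩
    u ^ (v * K + r)                ≡⟨ cong (u ^_) D≡ ⟩
    u ^ D                          ∎
    where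
    open ≤-Reasoning
    r = D ∸ v * K
    D≡ : v * K + r ≡ D
    D≡ = m+[n∸m]≡n vK≤D

  -- The exponential tilt with bias 1/q, q = 2c, where c = suc c′ throughout:
  -- among D surplus heads and d ≤ cD heads/tails pairs it gains the factor (u/v)^D.
  q⁻ q q⁺ tiltU tiltV : ℕ → ℕ
  q⁻ c′ = suc (c′ + c′)
  q  c′ = suc (q⁻ c′)
  q⁺ c′ = suc (q c′)
  tiltU c′ = (q⁺ c′ * q⁻ c′) ^ suc c′ * q⁺ c′
  tiltV c′ = (q c′ * q c′) ^ suc c′ * q c′

  tiltV≢0 : ∀ c′ → NonZero (tiltV c′)
  tiltV≢0 c′ = m*n≢0 _ _ {{m^n≢0 (q c′ * q c′) (suc c′)}}

  q²≡ : ∀ c′ → q c′ * q c′ ≡ suc (q⁺ c′ * q⁻ c′)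
  q²≡ = ring
    where
    ring : ∀ c → suc (suc (c + c)) * suc (suc (c + c)) ≡ suc (suc (suc (suc (c + c))) * suc (c + c))
    ring = solve-∀

  -- The ratio of the two sides is (1 - 1/q²)^c (1 + 1/q), which is at least (1 - c/q²)(1 + 1/q) by
  -- `bernoulli-pred`. This exceeds 1 as soon as c (q + 1) < q², and q = 2c ensures that.
  tilt-gain : ∀ c′ → tiltV c′ < tiltU c′
  tilt-gain c′ = *-cancelʳ-< (suc s) _ _ (+-cancelʳ-< (c * Q^c * suc (q c′)) _ _ (begin-strict
    tiltV c′ * suc s + c * Q^c * suc (q c′)  ≡⟨ cong (λ z → z ^ c * q c′ * suc s + c * Q^c * suc (q c′)) (q²≡ c′) ⟩
    Q^c * q c′ * suc s + c * Q^c * suc (q c′) ≡⟨ factor Q^c (q c′) (suc s) c ⟩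
    Q^c * (q c′ * suc s + c * suc (q c′))     <⟨ *-monoʳ-< Q^c {{m^n≢0 (suc s) c}} (+-monoʳ-< (q c′ * suc s) small) ⟩
    Q^c * (q c′ * suc s + suc s)              ≡⟨ regroup Q^c (q c′) (suc s) ⟩
    Q^c * suc s * suc (q c′)                  ≤⟨ *-monoˡ-≤ (suc (q c′)) (bernoulli-pred s c) ⟩
    (s ^ c * suc s + c * Q^c) * suc (q c′)    ≡⟨ expand (s ^ c) (suc s) (suc (q c′)) (c * Q^c) ⟩
    tiltU c′ * suc s + c * Q^c * suc (q c′)   ∎))
    where
    open ≤-Reasoning
    c = suc c′
    s = q⁺ c′ * q⁻ c′
    Q^c = suc s ^ c
    factor : ∀ x q s c → x * q * s + c * x * suc q ≡ x * (q * s + c * suc q)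
    factor = solve-∀
    regroup : ∀ x q s → x * (q * s + s) ≡ x * s * suc q
    regroup = solve-∀
    expand : ∀ x s q y → (x * s + y) * q ≡ x * q * s + y * q
    expand = solve-∀
    split : ∀ c → suc (suc c * suc (suc (suc (c + c)))) + (c + c + c + c * c + c * c) ≡ suc (suc (suc (suc (c + c))) * suc (c + c))
    split = solve-∀
    small : c * suc (q c′) < suc s
    small = subst (c * suc (q c′) <_) (split c′) (s≤s (m≤m+n _ _))

  -- Each of the `d` balanced pairs costs a factor 1 - 1/q². Multiplying both sides by `Q ^ e` pads
  -- their number to exactly cD: the left side becomes `2 ^ K * tiltV c′ ^ D`, and the right side is
  -- at least `tiltU c′ ^ D` because `s ≤ Q`.
  tilted-weight : ∀ c′ K d D → tiltV c′ * K ≤ D → d ≤ suc c′ * D →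
    2 ^ K * q c′ ^ ((d + D) + d) ≤ q⁺ c′ ^ (d + D) * q⁻ c′ ^ d
  tilted-weight c′ K d D VK≤D d≤cD = *-cancelʳ-≤ _ _ (Q ^ e) {{m^n≢0 Q e}} (begin
    2 ^ K * q c′ ^ ((d + D) + d) * Q ^ e          ≡⟨ *-assoc (2 ^ K) _ _ ⟩
    2 ^ K * (q c′ ^ ((d + D) + d) * Q ^ e)        ≡⟨ cong (2 ^ K *_) base ⟩
    2 ^ K * tiltV c′ ^ D                          ≤⟨ exponential-growth {{tiltV≢0 c′}} K D (tilt-gain c′) VK≤D ⟩
    tiltU c′ ^ D                                  ≡⟨ power (q⁺ c′ * q⁻ c′) (q⁺ c′) ⟩
    s ^ d * s ^ e * q⁺ c′ ^ D                     ≤⟨ *-monoˡ-≤ (q⁺ c′ ^ D) (*-monoʳ-≤ (s ^ d) (^-monoˡ-≤ e s≤Q)) ⟩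
    s ^ d * Q ^ e * q⁺ c′ ^ D                     ≡⟨ cong (λ z → z * Q ^ e * q⁺ c′ ^ D) (^-distribʳ-* d (q⁺ c′) (q⁻ c′)) ⟩
    q⁺ c′ ^ d * q⁻ c′ ^ d * Q ^ e * q⁺ c′ ^ D     ≡⟨ shuffle (q⁺ c′ ^ d) (q⁻ c′ ^ d) (Q ^ e) (q⁺ c′ ^ D) ⟩
    q⁺ c′ ^ d * q⁺ c′ ^ D * q⁻ c′ ^ d * Q ^ e     ≡⟨ cong (λ z → z * q⁻ c′ ^ d * Q ^ e) (sym (^-distribˡ-+-* (q⁺ c′) d D)) ⟩
    q⁺ c′ ^ (d + D) * q⁻ c′ ^ d * Q ^ e           ∎)
    where
    open ≤-Reasoning
    Q = q c′ * q c′
    s = q⁺ c′ * q⁻ c′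
    e = suc c′ * D ∸ d
    s≤Q : s ≤ Q
    s≤Q = subst (s ≤_) (sym (q²≡ c′)) (n≤1+n s)
    power : ∀ x y → (x ^ suc c′ * y) ^ D ≡ x ^ d * x ^ e * y ^ D
    power x y = trans (^-distribʳ-* D (x ^ suc c′) y)
      (cong (_* y ^ D) (trans (^-*-assoc x (suc c′) D)
        (trans (cong (x ^_) (sym (m+[n∸m]≡n d≤cD))) (^-distribˡ-+-* x d e))))
    shuffle : ∀ a b x y → a * b * x * y ≡ a * y * b * x
    shuffle = solve-∀
    base : q c′ ^ ((d + D) + d) * Q ^ e ≡ tiltV c′ ^ D
    base = sym (trans (power Q (q c′)) (trans
      (cong (λ z → z * Q ^ e * q c′ ^ D) (^-distribʳ-* d (q c′) (q c′)))
      (trans (shuffle′ (q c′ ^ d) (Q ^ e) (q c′ ^ D))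
        (cong (_* Q ^ e) (sym (trans (^-distribˡ-+-* (q c′) (d + D) d)
          (cong (_* q c′ ^ d) (^-distribˡ-+-* (q c′) d D))))))))
      where
      shuffle′ : ∀ a x y → a * a * x * y ≡ a * y * a * x
      shuffle′ = solve-∀

  -- Sums and enumerations

  ind : Bool → ℕ
  ind true  = 1
  ind false = 0

  card : ∀ {n} → (Fin n → Bool) → ℕ
  card A = sum (ind ∘ A)

  card₂ : ∀ {n} → (Fin n → Fin n → Bool) → ℕ
  card₂ L = sum (λ i → card (L i))

  ind-∧ : ∀ a b → ind (a ∧ b) ≡ ind a * ind b
  ind-∧ true  b = sym (+-identityʳ (ind b))
  ind-∧ false b = refl

  ind-split : ∀ a b → ind (a ∧ b) + ind (a ∧ not b) ≡ ind a
  ind-split true  true  = refl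
  ind-split true  false = refl
  ind-split false _     = refl

  sum-mono-≤ : ∀ {n} {f g : Fin n → ℕ} → (∀ i → f i ≤ g i) → sum f ≤ sum g
  sum-mono-≤ {zero}  f≤g = z≤n
  sum-mono-≤ {suc n} f≤g = +-mono-≤ (f≤g zero) (sum-mono-≤ (λ i → f≤g (suc i)))

  sum-+-cong : ∀ {n} {f g h : Fin n → ℕ} → (∀ i → f i + g i ≡ h i) → sum f + sum g ≡ sum h
  sum-+-cong {f = f} {g} fg≡h = trans (sym (∑-distrib-+ f g)) (sum-cong-≗ fg≡h)

  card₂-× : ∀ {n} (A B : Fin n → Bool) → card₂ (λ i j → A i ∧ B j) ≡ card A * card B
  card₂-× A B = trans
    (sum-cong-≗ (λ i → trans (sum-cong-≗ (λ j → ind-∧ (A i) (B j))) (sym (*-distribˡ-sum (ind (A i)) (ind ∘ B)))))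
    (sym (*-distribʳ-sum (card B) (ind ∘ A)))

  sumₗ : ∀ {X : Set} → (X → ℕ) → List X → ℕ
  sumₗ f xs = ListAction.sum (List.map f xs)

  module _ {X : Set} where

    sumₗ-++ : ∀ (f : X → ℕ) xs ys → sumₗ f (xs ++ ys) ≡ sumₗ f xs + sumₗ f ys
    sumₗ-++ f []       ys = refl
    sumₗ-++ f (x ∷ xs) ys = trans (cong (f x +_) (sumₗ-++ f xs ys)) (sym (+-assoc (f x) _ _))

    sumₗ-mono-≤ : ∀ {f g : X → ℕ} → (∀ x → f x ≤ g x) → ∀ xs → sumₗ f xs ≤ sumₗ g xs
    sumₗ-mono-≤ f≤g []       = z≤n
    sumₗ-mono-≤ f≤g (x ∷ xs) = +-mono-≤ (f≤g x) (sumₗ-mono-≤ f≤g xs)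

    sumₗ-+ : ∀ (f g : X → ℕ) xs → sumₗ (λ x → f x + g x) xs ≡ sumₗ f xs + sumₗ g xs
    sumₗ-+ f g []       = refl
    sumₗ-+ f g (x ∷ xs) = trans (cong (f x + g x +_) (sumₗ-+ f g xs)) (swap (f x) (g x) _ _)
      where
      swap : ∀ a b c d → a + b + (c + d) ≡ a + c + (b + d)
      swap = solve-∀

    sumₗ-* : ∀ k (f : X → ℕ) xs → sumₗ (λ x → k * f x) xs ≡ k * sumₗ f xs
    sumₗ-* k f []       = sym (*-zeroʳ k)
    sumₗ-* k f (x ∷ xs) = trans (cong (k * f x +_) (sumₗ-* k f xs)) (sym (*-distribˡ-+ k (f x) _))

    sumₗ-1 : ∀ (xs : List X) → sumₗ (λ _ → 1) xs ≡ length xs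
    sumₗ-1 []       = refl
    sumₗ-1 (x ∷ xs) = cong suc (sumₗ-1 xs)

  sumₗ-product : ∀ {X Y Z : Set} (_⊗_ : X → Y → Z) (f : Z → ℕ) (g : X → ℕ) (h : Y → ℕ) →
    (∀ x y → f (x ⊗ y) ≡ g x * h y) → ∀ xs ys →
    sumₗ f (cartesianProductWith _⊗_ xs ys) ≡ sumₗ g xs * sumₗ h ys
  sumₗ-product {X} {Y} _⊗_ f g h f≡gh []       ys = refl
  sumₗ-product {X} {Y} _⊗_ f g h f≡gh (x ∷ xs) ys = trans
    (sumₗ-++ f (List.map (x ⊗_) ys) _)
    (trans (cong₂ _+_ (row ys) (sumₗ-product _⊗_ f g h f≡gh xs ys)) (sym (*-distribʳ-+ (sumₗ h ys) (g x) _)))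
    where
    row : ∀ (ys : List Y) → sumₗ f (List.map (x ⊗_) ys) ≡ g x * sumₗ h ys
    row []       = sym (*-zeroʳ (g x))
    row (y ∷ ys) = trans (cong₂ _+_ (f≡gh x y) (row ys)) (sym (*-distribˡ-+ (g x) (h y) _))

  -- A tournament on suc n vertices: the arcs at vertex zero, then the rest.
  infixr 5 _▹_
  data Code : ℕ → Set where
    ε   : Code 0
    _▹_ : ∀ {n} → Vec Bool n → Code n → Code (suc n)

  arcs : ∀ {n} → Code n → Fin n → Fin n → Bool
  arcs (v ▹ x) zero    zero    = false
  arcs (v ▹ x) zero    (suc j) = lookup v j
  arcs (v ▹ x) (suc i) zero    = not (lookup v i)
  arcs (v ▹ x) (suc i) (suc j) = arcs x i j

  pairs : ℕ → ℕ
  pairs zero    = 0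
  pairs (suc n) = n + pairs n

  vecs : ∀ n → List (Vec Bool n)
  vecs zero    = [] ∷ []
  vecs (suc n) = cartesianProductWith _∷_ (true ∷ false ∷ []) (vecs n)

  codes : ∀ n → List (Code n)
  codes zero    = ε ∷ []
  codes (suc n) = cartesianProductWith _▹_ (vecs n) (codes n)

  ∈-vecs : ∀ {n} (v : Vec Bool n) → v List.∈ vecs n
  ∈-vecs []          = here refl
  ∈-vecs (true  ∷ v) = ∈-cartesianProductWith⁺ _∷_ {xs = true ∷ false ∷ []} (here refl) (∈-vecs v)
  ∈-vecs (false ∷ v) = ∈-cartesianProductWith⁺ _∷_ {xs = true ∷ false ∷ []} (there (here refl)) (∈-vecs v)

  vecs-unique : ∀ n → Unique (vecs n)
  vecs-unique zero    = [] ∷ []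
  vecs-unique (suc n) = Uniqueₚ.cartesianProductWith⁺ _∷_ (λ { refl → refl , refl })
    (((λ ()) ∷ []) ∷ [] ∷ []) (vecs-unique n)

  codes-unique : ∀ n → Unique (codes n)
  codes-unique zero    = [] ∷ []
  codes-unique (suc n) = Uniqueₚ.cartesianProductWith⁺ _▹_ (λ { refl → refl , refl })
    (vecs-unique n) (codes-unique n)

  length-vecs : ∀ n → length (vecs n) ≡ 2 ^ n
  length-vecs n = trans (sym (sumₗ-1 (vecs n))) (go n)
    where
    go : ∀ n → sumₗ (λ _ → 1) (vecs n) ≡ 2 ^ n
    go zero    = refl
    go (suc n) = trans (sumₗ-product _∷_ (λ _ → 1) (λ _ → 1) (λ _ → 1) (λ _ _ → refl) (true ∷ false ∷ []) (vecs n))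
      (cong (2 *_) (go n))

  length-codes : ∀ n → length (codes n) ≡ 2 ^ pairs n
  length-codes n = trans (sym (sumₗ-1 (codes n))) (go n)
    where
    go : ∀ n → sumₗ (λ _ → 1) (codes n) ≡ 2 ^ pairs n
    go zero    = refl
    go (suc n) = trans (sumₗ-product _▹_ (λ _ → 1) (λ _ → 1) (λ _ → 1) (λ _ _ → refl) (vecs n) (codes n))
      (trans (cong₂ _*_ (trans (sumₗ-1 (vecs n)) (length-vecs n)) (go n)) (sym (^-distribˡ-+-* 2 n (pairs n))))

  -- The Chernoff bound

  -- wt l l′ b is the weight of the pair {i, j} whose arc is i → j exactly if b;
  -- l and l′ say whether i → j resp. j → i is one of the arcs being counted.
  wt : ℕ → Bool → Bool → Bool → ℕ
  wt c′ true  false true  = q⁺ c′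
  wt c′ true  false false = q⁻ c′
  wt c′ false true  true  = q⁻ c′
  wt c′ false true  false = q⁺ c′
  wt c′ true  true  _     = q c′
  wt c′ false false _     = q c′

  rowWeight : ∀ {n} → ℕ → (l l′ : Fin n → Bool) → Vec Bool n → ℕ
  rowWeight c′ l l′ []      = 1
  rowWeight c′ l l′ (b ∷ v) = wt c′ (l zero) (l′ zero) b * rowWeight c′ (l ∘ suc) (l′ ∘ suc) v

  weight : ∀ {n} → ℕ → (Fin n → Fin n → Bool) → Code n → ℕ
  weight c′ L ε       = 1
  weight c′ L (v ▹ x) =
    rowWeight c′ (λ j → L zero (suc j)) (λ j → L (suc j) zero) v * weight c′ (λ i j → L (suc i) (suc j)) x

  -- Whichever of `l` and `l′` hold at an entry, its two orientations weigh 2q together, and the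
  -- weight of a row is a product over its entries.
  sumₗ-rowWeight : ∀ c′ n (l l′ : Fin n → Bool) → sumₗ (rowWeight c′ l l′) (vecs n) ≡ (2 * q c′) ^ n
  sumₗ-rowWeight c′ zero    l l′ = refl
  sumₗ-rowWeight c′ (suc n) l l′ = trans
    (sumₗ-product _∷_ (rowWeight c′ l l′) (wt c′ (l zero) (l′ zero)) (rowWeight c′ (l ∘ suc) (l′ ∘ suc))
      (λ _ _ → refl) (true ∷ false ∷ []) (vecs n))
    (cong₂ _*_ (two (l zero) (l′ zero)) (sumₗ-rowWeight c′ n (l ∘ suc) (l′ ∘ suc)))
    where
    sym±₁ : ∀ p → suc (suc p) + (p + 0) ≡ suc p + (suc p + 0)
    sym±₁ = solve-∀
    sym±₂ : ∀ p → p + (suc (suc p) + 0) ≡ suc p + (suc p + 0)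
    sym±₂ = solve-∀
    two : ∀ a b → wt c′ a b true + (wt c′ a b false + 0) ≡ 2 * q c′
    two true  true  = refl
    two true  false = sym±₁ (q⁻ c′)
    two false true  = sym±₂ (q⁻ c′)
    two false false = refl

  sumₗ-weight : ∀ c′ n (L : Fin n → Fin n → Bool) → sumₗ (weight c′ L) (codes n) ≡ (2 * q c′) ^ pairs n
  sumₗ-weight c′ zero    L = refl
  sumₗ-weight c′ (suc n) L = trans
    (sumₗ-product _▹_ (weight c′ L) _ _ (λ _ _ → refl) (vecs n) (codes n))
    (trans (cong₂ _*_ (sumₗ-rowWeight c′ n _ _) (sumₗ-weight c′ n _)) (sym (^-distribˡ-+-* (2 * q c′) n (pairs n))))

  agree disagree : ∀ {n} → (Fin n → Fin n → Bool) → Code n → ℕ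
  agree    L x = card₂ (λ i j → L i j ∧ arcs x i j)
  disagree L x = card₂ (λ i j → L i j ∧ arcs x j i)

  -- W = q⁺^a q⁻^d q^(N − a − d), multiplied out by q^(a + d) to avoid the subtraction.
  record _⟨_,_,_⟩≡_ (c′ a d N W : ℕ) : Set where
    constructor factors
    field factorization : W * q c′ ^ (a + d) ≡ q⁺ c′ ^ a * q⁻ c′ ^ d * q c′ ^ N
  open _⟨_,_,_⟩≡_

  factor-* : ∀ c′ {a d N W a′ d′ N′ W′} → c′ ⟨ a , d , N ⟩≡ W → c′ ⟨ a′ , d′ , N′ ⟩≡ W′ →
    c′ ⟨ a + a′ , d + d′ , N + N′ ⟩≡ (W * W′)
  factor-* c′ {a} {d} {N} {W} {a′} {d′} {N′} {W′} (factors h) (factors h′) = factors (begin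
    W * W′ * q c′ ^ (a + a′ + (d + d′))            ≡⟨ cong (λ z → W * W′ * q c′ ^ z) (swap a a′ d d′) ⟩
    W * W′ * q c′ ^ (a + d + (a′ + d′))            ≡⟨ cong (W * W′ *_) (^-distribˡ-+-* (q c′) (a + d) (a′ + d′)) ⟩
    W * W′ * (q c′ ^ (a + d) * q c′ ^ (a′ + d′))   ≡⟨ inter W W′ (q c′ ^ (a + d)) (q c′ ^ (a′ + d′)) ⟩
    (W * q c′ ^ (a + d)) * (W′ * q c′ ^ (a′ + d′)) ≡⟨ cong₂ _*_ h h′ ⟩
    (q⁺ c′ ^ a * q⁻ c′ ^ d * q c′ ^ N) * (q⁺ c′ ^ a′ * q⁻ c′ ^ d′ * q c′ ^ N′)
      ≡⟨ inter₃ (q⁺ c′ ^ a) (q⁻ c′ ^ d) (q c′ ^ N) (q⁺ c′ ^ a′) (q⁻ c′ ^ d′) (q c′ ^ N′) ⟩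
    (q⁺ c′ ^ a * q⁺ c′ ^ a′) * (q⁻ c′ ^ d * q⁻ c′ ^ d′) * (q c′ ^ N * q c′ ^ N′)
      ≡⟨ sym (cong₂ _*_ (cong₂ _*_ (^-distribˡ-+-* (q⁺ c′) a a′) (^-distribˡ-+-* (q⁻ c′) d d′)) (^-distribˡ-+-* (q c′) N N′)) ⟩
    q⁺ c′ ^ (a + a′) * q⁻ c′ ^ (d + d′) * q c′ ^ (N + N′) ∎)
    where
    open ≡-Reasoning
    swap : ∀ a b c d → a + b + (c + d) ≡ a + c + (b + d)
    swap = solve-∀
    inter : ∀ a b c d → a * b * (c * d) ≡ (a * c) * (b * d)
    inter = solve-∀
    inter₃ : ∀ a b c x y z → (a * b * c) * (x * y * z) ≡ (a * x) * (b * y) * (c * z)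
    inter₃ = solve-∀

  -- The arc from `j` back to the vertex of this row is present when `lookup v j` is false, so the
  -- terms with `l′` are negated. Disjointness matters: with both directions counted, a pair would
  -- agree once and contradict once, but its weight q is not the q⁺q⁻/q that the factorization asks
  -- for.
  factor-row : ∀ c′ {n} (l l′ : Fin n → Bool) (v : Vec Bool n) → (∀ j → l j ∧ l′ j ≡ false) →
    c′ ⟨ sum (λ j → ind (l j ∧ lookup v j) + ind (l′ j ∧ not (lookup v j)))
       , sum (λ j → ind (l j ∧ not (lookup v j)) + ind (l′ j ∧ lookup v j)) , n ⟩≡ rowWeight c′ l l′ v
  factor-row c′ l l′ []      _        = factors refl
  factor-row c′ l l′ (b ∷ v) disjoint = factor-* c′
    (one (l zero) (l′ zero) b (disjoint zero))
    (factor-row c′ (l ∘ suc) (l′ ∘ suc) v (disjoint ∘ suc))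
    where
    one⁺ : ∀ x y → x * (y * 1) ≡ x * 1 * 1 * (y * 1)
    one⁺ = solve-∀
    one⁻ : ∀ x y → x * (y * 1) ≡ 1 * (x * 1) * (y * 1)
    one⁻ = solve-∀
    one⁰ : ∀ y → y * 1 ≡ 1 * 1 * (y * 1)
    one⁰ = solve-∀
    one : ∀ l l′ b → l ∧ l′ ≡ false →
      c′ ⟨ ind (l ∧ b) + ind (l′ ∧ not b) , ind (l ∧ not b) + ind (l′ ∧ b) , 1 ⟩≡ wt c′ l l′ b
    one true  false true  _ = factors (one⁺ (q⁺ c′) (q c′))
    one true  false false _ = factors (one⁻ (q⁻ c′) (q c′))
    one false true  true  _ = factors (one⁻ (q⁻ c′) (q c′))
    one false true  false _ = factors (one⁺ (q⁺ c′) (q c′))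
    one false false b     _ = factors (one⁰ (q c′))

  card₂-suc : ∀ {n} (L : Fin (suc n) → Fin (suc n) → Bool) → L zero zero ≡ false →
    card₂ L ≡ sum (λ j → ind (L zero (suc j)) + ind (L (suc j) zero)) + card₂ (λ i j → L (suc i) (suc j))
  card₂-suc L L₀₀ = begin
    ind (L zero zero) + X + sum (λ i → ind (L (suc i) zero) + card (λ j → L (suc i) (suc j)))
      ≡⟨ cong₂ _+_ (cong (λ b → ind b + X) L₀₀) (∑-distrib-+ (λ i → ind (L (suc i) zero)) _) ⟩
    X + (Y + Z) ≡⟨ sym (+-assoc X Y Z) ⟩
    X + Y + Z   ≡⟨ cong (_+ Z) (sym (∑-distrib-+ (λ j → ind (L zero (suc j))) _)) ⟩
    sum (λ j → ind (L zero (suc j)) + ind (L (suc j) zero)) + Z ∎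
    where
    open ≡-Reasoning
    X = sum (λ j → ind (L zero (suc j)))
    Y = sum (λ i → ind (L (suc i) zero))
    Z = card₂ (λ i j → L (suc i) (suc j))

  factor-weight : ∀ c′ {n} (L : Fin n → Fin n → Bool) (x : Code n) → (∀ i j → L i j ∧ L j i ≡ false) →
    c′ ⟨ agree L x , disagree L x , pairs n ⟩≡ weight c′ L x
  factor-weight c′ L ε       _        = factors refl
  factor-weight c′ {suc n} L (v ▹ x) disjoint =
    subst₂ (λ a d → c′ ⟨ a , d , n + pairs n ⟩≡ weight c′ L (v ▹ x))
      (sym (card₂-suc (λ i j → L i j ∧ arcs (v ▹ x) i j) (∧-zeroʳ (L zero zero))))
      (sym (card₂-suc (λ i j → L i j ∧ arcs (v ▹ x) j i) (∧-zeroʳ (L zero zero))))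
      (factor-* c′
        (factor-row c′ (λ j → L zero (suc j)) (λ j → L (suc j) zero) v (λ j → disjoint zero (suc j)))
        (factor-weight c′ (λ i j → L (suc i) (suc j)) x (λ i j → disjoint (suc i) (suc j))))

  agree+disagree : ∀ {n} (L : Fin n → Fin n → Bool) (x : Code n) → (∀ i → L i i ≡ false) →
    agree L x + disagree L x ≡ card₂ L
  agree+disagree L x irr = sum-+-cong (λ i → sum-+-cong (λ j → complement L x irr i j))
    where
    complement : ∀ {n} (L : Fin n → Fin n → Bool) (x : Code n) → (∀ i → L i i ≡ false) → ∀ i j →
      ind (L i j ∧ arcs x i j) + ind (L i j ∧ arcs x j i) ≡ ind (L i j)
    complement L (v ▹ x) irr zero    zero    rewrite irr zero = refl
    complement L (v ▹ x) irr zero    (suc j) = ind-split (L zero (suc j)) (lookup v j)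
    complement L (v ▹ x) irr (suc i) zero    =
      trans (+-comm (ind (L (suc i) zero ∧ not (lookup v i))) _) (ind-split (L (suc i) zero) (lookup v i))
    complement L (v ▹ x) irr (suc i) (suc j) = complement (λ i j → L (suc i) (suc j)) x (irr ∘ suc) i j

  edges : ∀ {n} → (A B : Fin n → Bool) → Code n → ℕ
  edges A B = agree (λ i j → A i ∧ B j)

  threshold : ℕ → ℕ → ℕ
  threshold c′ K = suc (suc c′ + suc c′) * (tiltV c′ * K)

  -- With c = suc c′: at least a fraction (c + 1)/(2c + 1) of the pairs in A × B are arcs,
  -- and there are enough such pairs for this to have probability at most 2^(−K).
  Heavy : ∀ {n} → ℕ → ℕ → (A B : Fin n → Bool) → Code n → Bool
  Heavy c′ K A B x = (threshold c′ K ≤ᵇ card A * card B)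
    ∧ (suc (suc c′) * (card A * card B) ≤ᵇ suc (suc c′ + suc c′) * edges A B x)

  -- With c = `suc c′`, the density condition amounts to (c + 1) d ≤ c a, that is, d ≤ c (a - d).
  -- Then a + d ≤ (2c + 1)(a - d), so the factor 2c + 1 in `threshold` is exactly what the passage
  -- from pairs to surplus costs.
  heavy-surplus : ∀ c′ K a d → threshold c′ K ≤ a + d → suc (suc c′) * (a + d) ≤ suc (suc c′ + suc c′) * a →
    ∃[ D ] (a ≡ d + D × tiltV c′ * K ≤ D × d ≤ suc c′ * D)
  heavy-surplus c′ K a d large heavy = D , sym a≡ , VK≤D , d≤cD
    where
    open ≤-Reasoning
    c = suc c′
    step₁ : suc c * d ≤ c * a
    step₁ = +-cancelˡ-≤ (suc c * a) _ _ (begin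
      suc c * a + suc c * d ≡⟨ sym (*-distribˡ-+ (suc c) a d) ⟩
      suc c * (a + d)       ≤⟨ heavy ⟩
      suc (c + c) * a       ≡⟨ *-distribʳ-+ a (suc c) c ⟩
      suc c * a + c * a     ∎)
    d≤a : d ≤ a
    d≤a = *-cancelˡ-≤ c (≤-trans (m≤n+m (c * d) d) step₁)
    D = a ∸ d
    a≡ : d + D ≡ a
    a≡ = m+[n∸m]≡n d≤a
    d≤cD : d ≤ c * D
    d≤cD = +-cancelʳ-≤ (c * d) _ _ (begin
      d + c * d     ≤⟨ step₁ ⟩
      c * a         ≡⟨ cong (c *_) (sym a≡) ⟩
      c * (d + D)   ≡⟨ trans (*-distribˡ-+ c d D) (+-comm (c * d) (c * D)) ⟩
      c * D + c * d ∎)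
    VK≤D : tiltV c′ * K ≤ D
    VK≤D = *-cancelˡ-≤ (suc (c + c)) (begin
      suc (c + c) * (tiltV c′ * K) ≤⟨ large ⟩
      a + d                        ≡⟨ cong (_+ d) (sym a≡) ⟩
      d + D + d                    ≡⟨ ring₁ d D ⟩
      d + d + D                    ≤⟨ +-monoˡ-≤ D (+-mono-≤ d≤cD d≤cD) ⟩
      c * D + c * D + D            ≡⟨ ring₂ c D ⟩
      suc (c + c) * D              ∎)
      where
      ring₁ : ∀ d D → d + D + d ≡ d + d + D
      ring₁ = solve-∀
      ring₂ : ∀ c D → c * D + c * D + D ≡ suc (c + c) * D
      ring₂ = solve-∀

  heavy-weight : ∀ c′ K {n} (A B : Fin n → Bool) → (∀ i → A i ∧ B i ≡ false) → ∀ x →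
    2 ^ K * q c′ ^ pairs n * ind (Heavy c′ K A B x) ≤ weight c′ (λ i j → A i ∧ B j) x
  heavy-weight c′ K {n} A B disjoint x with Heavy c′ K A B x in eq
  ... | false = ≤-trans (≤-reflexive (*-zeroʳ (2 ^ K * q c′ ^ pairs n))) z≤n
  ... | true with Equivalence.to Boolₚ.T-∧ (subst T (sym eq) _)
  ...   | large , heavy with heavy-surplus c′ K a d
          (subst (threshold c′ K ≤_) (sym a+d≡) (≤ᵇ⇒≤ _ _ large))
          (subst (λ m → suc (suc c′) * m ≤ suc (suc c′ + suc c′) * a) (sym a+d≡) (≤ᵇ⇒≤ _ _ heavy))
    where
    L : Fin n → Fin n → Bool
    L i j = A i ∧ B j
    a = agree L x
    d = disagree L x
    a+d≡ : a + d ≡ card A * card B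
    a+d≡ = trans (agree+disagree L x disjoint) (card₂-× A B)
  ...     | D , a≡ , VK≤D , d≤cD = *-cancelʳ-≤ _ _ (q c′ ^ (a + d)) {{m^n≢0 (q c′) (a + d)}} (begin
    2 ^ K * q c′ ^ pairs n * 1 * q c′ ^ (a + d)           ≡⟨ ring₁ (2 ^ K) (q c′ ^ pairs n) (q c′ ^ (a + d)) ⟩
    2 ^ K * q c′ ^ (a + d) * q c′ ^ pairs n               ≤⟨ *-monoˡ-≤ (q c′ ^ pairs n)
      (subst (λ z → 2 ^ K * q c′ ^ (z + d) ≤ q⁺ c′ ^ z * q⁻ c′ ^ d) (sym a≡) (tilted-weight c′ K d D VK≤D d≤cD)) ⟩
    q⁺ c′ ^ a * q⁻ c′ ^ d * q c′ ^ pairs n                ≡⟨ sym (factorization (factor-weight c′ L x antisym)) ⟩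
    weight c′ L x * q c′ ^ (a + d)                        ∎)
    where
    open ≤-Reasoning
    L : Fin n → Fin n → Bool
    L i j = A i ∧ B j
    a = agree L x
    d = disagree L x
    ring₁ : ∀ x y z → x * y * 1 * z ≡ x * z * y
    ring₁ = solve-∀
    antisym : ∀ i j → L i j ∧ L j i ≡ false
    antisym i j with A i | B i | disjoint i
    ... | true  | false | _ = trans (cong (B j ∧_) (∧-zeroʳ (A j))) (∧-zeroʳ (B j))
    ... | false | _     | _ = refl

  -- Markov's inequality for the weight: by `heavy-weight` it is at least 2^K q^N on the event,
  -- where N is the number of pairs, while its total is (2q)^N.
  heavy-rare : ∀ c′ K {n} (A B : Fin n → Bool) → (∀ i → A i ∧ B i ≡ false) →
    2 ^ K * sumₗ (ind ∘ Heavy c′ K A B) (codes n) ≤ 2 ^ pairs n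
  heavy-rare c′ K {n} A B disjoint = *-cancelʳ-≤ _ _ (q c′ ^ pairs n) {{m^n≢0 (q c′) (pairs n)}} (begin
    2 ^ K * S * q c′ ^ pairs n                                       ≡⟨ ring₁ (2 ^ K) S (q c′ ^ pairs n) ⟩
    2 ^ K * q c′ ^ pairs n * S                                       ≡⟨ sym (sumₗ-* (2 ^ K * q c′ ^ pairs n) _ (codes n)) ⟩
    sumₗ (λ x → 2 ^ K * q c′ ^ pairs n * ind (Heavy c′ K A B x)) (codes n) ≤⟨ sumₗ-mono-≤ (heavy-weight c′ K A B disjoint) (codes n) ⟩
    sumₗ (weight c′ (λ i j → A i ∧ B j)) (codes n)                  ≡⟨ sumₗ-weight c′ n _ ⟩
    (2 * q c′) ^ pairs n                                             ≡⟨ ^-distribʳ-* (pairs n) 2 (q c′) ⟩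
    2 ^ pairs n * q c′ ^ pairs n                                     ∎)
    where
    open ≤-Reasoning
    S = sumₗ (ind ∘ Heavy c′ K A B) (codes n)
    ring₁ : ∀ x y z → x * y * z ≡ x * z * y
    ring₁ = solve-∀

  -- The union bound

  tournament : ∀ {n} → Code n → Tournament n
  tournament x = record { arc = arcs x ; irrefl = irr x ; oneWay = one x ; total = tot x }
    where
    not-true : ∀ {b} → b ≡ true → not b ≡ false
    not-true refl = refl
    not-false : ∀ {b} → b ≡ false → not b ≡ true
    not-false refl = refl
    irr : ∀ {n} (x : Code n) i → arcs x i i ≡ false
    irr (v ▹ x) zero    = refl
    irr (v ▹ x) (suc i) = irr x i
    one : ∀ {n} (x : Code n) i j → arcs x i j ≡ true → arcs x j i ≡ false
    one (v ▹ x) zero    (suc j) h = not-true h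
    one (v ▹ x) (suc i) zero    h with lookup v i
    ... | false = refl
    one (v ▹ x) (suc i) (suc j) h = one x i j h
    tot : ∀ {n} (x : Code n) i j → i ≢ j → arcs x i j ≡ false → arcs x j i ≡ true
    tot (v ▹ x) zero    zero    i≢j h = contradiction refl i≢j
    tot (v ▹ x) zero    (suc j) i≢j h = not-false h
    tot (v ▹ x) (suc i) zero    i≢j h with lookup v i
    ... | true = refl
    tot (v ▹ x) (suc i) (suc j) i≢j h = tot x i j (i≢j ∘ cong suc) h

  arcs-injective : ∀ {n} (x y : Code n) → (∀ i j → arcs x i j ≡ arcs y i j) → x ≡ y
  arcs-injective ε       ε       h = refl
  arcs-injective (v ▹ x) (w ▹ y) h = cong₂ _▹_ (lookup-injective v w (λ j → h zero (suc j)))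
    (arcs-injective x y (λ i j → h (suc i) (suc j)))
    where
    lookup-injective : ∀ {n} (v w : Vec Bool n) → (∀ i → lookup v i ≡ lookup w i) → v ≡ w
    lookup-injective []      []      h = refl
    lookup-injective (b ∷ v) (c ∷ w) h = cong₂ _∷_ (h zero) (lookup-injective v w (h ∘ suc))

  tournament-distinct : ∀ {n} {x y : Code n} → x ≢ y → Distinct (tournament x) (tournament y)
  tournament-distinct {n} {x} {y} x≢y
    with i , ¬row ← ¬∀⟶∃¬ n _ (λ i → all? (λ j → arcs x i j Boolₚ.≟ arcs y i j)) (x≢y ∘ arcs-injective x y)
    with j , ¬ij ← ¬∀⟶∃¬ n _ (λ j → arcs x i j Boolₚ.≟ arcs y i j) ¬row
    = i , j , ¬ij

  pairs≡nC2 : ∀ n → pairs n ≡ n C 2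
  pairs≡nC2 zero    = refl
  pairs≡nC2 (suc n) = trans (cong₂ _+_ (sym (nC1≡n n)) (pairs≡nC2 n)) (nCk+nC[k+1]≡[n+1]C[k+1] n 1)

  length-filter≡sumₗ : ∀ {X : Set} {P : X → Set} (P? : Decidable P) xs →
    length (filter P? xs) ≡ sumₗ (ind ∘ does ∘ P?) xs
  length-filter≡sumₗ P? []       = refl
  length-filter≡sumₗ P? (x ∷ xs) with does (P? x)
  ... | true  = cong suc (length-filter≡sumₗ P? xs)
  ... | false = length-filter≡sumₗ P? xs

  sumₗ-comm : ∀ {X Y : Set} (f : X → Y → ℕ) xs ys →
    sumₗ (λ x → sumₗ (f x) ys) xs ≡ sumₗ (λ y → sumₗ (λ x → f x y) xs) ys
  sumₗ-comm f []       []       = refl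
  sumₗ-comm f []       (y ∷ ys) = sumₗ-comm f [] ys
  sumₗ-comm f (x ∷ xs) ys       = trans (cong (sumₗ (f x) ys +_) (sumₗ-comm f xs ys))
    (sym (sumₗ-+ (f x) (λ y → sumₗ (λ x → f x y) xs) ys))

  -- This is probability at least 1 - 1/j, multiplied by `j` and with the error moved across to
  -- avoid subtraction.
  AlmostAll : (n j : ℕ) → (Tournament n → Set) → Set
  AlmostAll n j P = ∃[ L ] (AllPairs Distinct L × All P L × j * 2 ^ (n C 2) ≤ j * length L + 2 ^ (n C 2))

  occurrences : ∀ {n} → List (Code n → Bool) → ℕ
  occurrences {n} = sumₗ (λ E → sumₗ (ind ∘ E) (codes n))

  Avoids : ∀ {n} → List (Code n → Bool) → Code n → Set
  Avoids Es x = All (λ E → E x ≡ false) Es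

  -- The list consists of the codes that avoid all events. Every other code lies in some event and
  -- is therefore counted at least once by `occurrences`.
  union-bound : ∀ {n} j {P : Tournament n → Set} (Es : List (Code n → Bool)) →
    j * occurrences Es ≤ 2 ^ pairs n → (∀ x → Avoids Es x → P (tournament x)) → AlmostAll n j P
  union-bound {n} j {P} Es rare avoid⇒P =
      map tournament xs
    , AllPairsₚ.map⁺ (AllPairs.map tournament-distinct (AllPairsₚ.filter⁺ avoids? (codes-unique n)))
    , Allₚ.map⁺ (All.map (avoid⇒P _) (Allₚ.all-filter avoids? (codes n)))
    , (begin
        j * 2 ^ (n C 2)                              ≡⟨ cong (λ z → j * 2 ^ z) (sym (pairs≡nC2 n)) ⟩
        j * 2 ^ pairs n                              ≤⟨ *-monoʳ-≤ j count ⟩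
        j * (length xs + occurrences Es)             ≡⟨ *-distribˡ-+ j _ _ ⟩
        j * length xs + j * occurrences Es           ≤⟨ +-mono-≤ (≤-reflexive (cong (j *_) (sym (length-map tournament xs)))) rare ⟩
        j * length (map tournament xs) + 2 ^ pairs n ≡⟨ cong (λ z → j * length (map tournament xs) + 2 ^ z) (pairs≡nC2 n) ⟩
        j * length (map tournament xs) + 2 ^ (n C 2) ∎)
    where
    open ≤-Reasoning
    avoids? : Decidable (Avoids Es)
    avoids? x = All.all? (λ E → E x Boolₚ.≟ false) Es
    xs = filter avoids? (codes n)
    none : ∀ {x} (Es : List (Code n → Bool)) → sumₗ (λ E → ind (E x)) Es ≡ 0 → Avoids Es x
    none []       _ = []
    none {x} (E ∷ Es) h with E x in eq
    ... | false = eq ∷ none Es h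
    covered : ∀ x → 1 ≤ ind (does (avoids? x)) + sumₗ (λ E → ind (E x)) Es
    covered x with avoids? x
    ... | yes _  = s≤s z≤n
    ... | no ¬av with sumₗ (λ E → ind (E x)) Es in eq
    ...   | zero  = contradiction (none Es eq) ¬av
    ...   | suc _ = s≤s z≤n
    count : 2 ^ pairs n ≤ length xs + occurrences Es
    count = begin
      2 ^ pairs n                      ≡⟨ sym (length-codes n) ⟩
      length (codes n)                 ≡⟨ sym (sumₗ-1 (codes n)) ⟩
      sumₗ (λ _ → 1) (codes n)        ≤⟨ sumₗ-mono-≤ covered (codes n) ⟩
      sumₗ (λ x → ind (does (avoids? x)) + sumₗ (λ E → ind (E x)) Es) (codes n)
        ≡⟨ sumₗ-+ (ind ∘ does ∘ avoids?) _ (codes n) ⟩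
      sumₗ (ind ∘ does ∘ avoids?) (codes n) + sumₗ (λ x → sumₗ (λ E → ind (E x)) Es) (codes n)
        ≡⟨ cong₂ _+_ (sym (length-filter≡sumₗ avoids? (codes n))) (sumₗ-comm (λ x E → ind (E x)) (codes n) Es) ⟩
      length xs + occurrences Es       ∎

  rare-family : ∀ {n} K j (Es : List (Code n → Bool)) → j * length Es ≤ 2 ^ K →
    All (λ E → 2 ^ K * sumₗ (ind ∘ E) (codes n) ≤ 2 ^ pairs n) Es → j * occurrences Es ≤ 2 ^ pairs n
  rare-family {n} K j Es j∣Es∣≤2^K rare = *-cancelˡ-≤ (2 ^ K) {{m^n≢0 2 K}} (begin
    2 ^ K * (j * occurrences Es)   ≡⟨ swap (2 ^ K) j (occurrences Es) ⟩
    j * (2 ^ K * occurrences Es)   ≤⟨ *-monoʳ-≤ j (sum-up Es rare) ⟩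
    j * (length Es * 2 ^ pairs n)  ≡⟨ sym (*-assoc j (length Es) (2 ^ pairs n)) ⟩
    j * length Es * 2 ^ pairs n    ≤⟨ *-monoˡ-≤ (2 ^ pairs n) j∣Es∣≤2^K ⟩
    2 ^ K * 2 ^ pairs n            ∎)
    where
    open ≤-Reasoning
    swap : ∀ x y z → x * (y * z) ≡ y * (x * z)
    swap = solve-∀
    sum-up : ∀ Es → All (λ E → 2 ^ K * sumₗ (ind ∘ E) (codes n) ≤ 2 ^ pairs n) Es →
      2 ^ K * occurrences Es ≤ length Es * 2 ^ pairs n
    sum-up []       []       = ≤-reflexive (*-zeroʳ (2 ^ K))
    sum-up (E ∷ Es) (h ∷ hs) = ≤-trans (≤-reflexive (*-distribˡ-+ (2 ^ K) _ _)) (+-mono-≤ h (sum-up Es hs))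

  n<2^n : ∀ n → n < 2 ^ n
  n<2^n zero    = s≤s z≤n
  n<2^n (suc n) = begin-strict
    suc n           <⟨ s≤s (n<2^n n) ⟩
    1 + 2 ^ n       ≤⟨ +-monoˡ-≤ (2 ^ n) (m^n>0 2 n) ⟩
    2 ^ n + 2 ^ n   ≡⟨ cong (2 ^ n +_) (sym (+-identityʳ (2 ^ n))) ⟩
    2 * 2 ^ n       ∎
    where open ≤-Reasoning

  -- The exponent 2K₀ with K₀ = ⌊n / 2M⌋ works because 2^(2K₀) ≥ (K₀ + 1)² is quadratic in n.
  linear-exponent : ∀ M .{{_ : NonZero M}} j n → M * 2 * (j * (M * 2)) ≤ n → ∃[ K ] (M * K ≤ n × j * n ≤ 2 ^ K)
  linear-exponent M j n large = 2 * K₀ , MK≤n , jn≤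
    where
    open ≤-Reasoning
    M₂ = M * 2
    instance
      M₂≢0 : NonZero M₂
      M₂≢0 = m*n≢0 M 2
    K₀ = n / M₂
    MK≤n : M * (2 * K₀) ≤ n
    MK≤n = ≤-trans (≤-reflexive (trans (sym (*-assoc M 2 K₀)) (*-comm M₂ K₀))) (m/n*n≤m n M₂)
    n≤ : n ≤ suc K₀ * M₂
    n≤ = begin
      n                    ≡⟨ m≡m%n+[m/n]*n n M₂ ⟩
      n % M₂ + K₀ * M₂     ≤⟨ +-monoˡ-≤ (K₀ * M₂) (<⇒≤ (m%n<n n M₂)) ⟩
      M₂ + K₀ * M₂         ∎
    jM₂≤K₀ : j * M₂ ≤ K₀
    jM₂≤K₀ = ≤-trans (≤-reflexive (sym (trans (cong (_/ M₂) (*-comm M₂ (j * M₂))) (m*n/n≡m (j * M₂) M₂)))) (/-monoˡ-≤ M₂ large)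
    jn≤ : j * n ≤ 2 ^ (2 * K₀)
    jn≤ = begin
      j * n                ≤⟨ *-monoʳ-≤ j n≤ ⟩
      j * (suc K₀ * M₂)    ≡⟨ swap j (suc K₀) M₂ ⟩
      suc K₀ * (j * M₂)    ≤⟨ *-mono-≤ (n<2^n K₀) (≤-trans jM₂≤K₀ (<⇒≤ (n<2^n K₀))) ⟩
      2 ^ K₀ * 2 ^ K₀      ≡⟨ sym (^-distribˡ-+-* 2 K₀ K₀) ⟩
      2 ^ (K₀ + K₀)        ≡⟨ cong (λ z → 2 ^ (K₀ + z)) (sym (+-identityʳ K₀)) ⟩
      2 ^ (2 * K₀)         ∎
      where
      swap : ∀ x y z → x * (y * z) ≡ y * (x * z)
      swap = solve-∀

  not-heavy : ∀ c′ K {n} (A B : Fin n → Bool) x → Heavy c′ K A B x ≡ false → threshold c′ K ≤ card A * card B →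
    suc (suc c′ + suc c′) * edges A B x < suc (suc c′) * (card A * card B)
  not-heavy c′ K A B x light large = ≰⇒> λ heavy →
    subst T light (Equivalence.from Boolₚ.T-∧ (≤⇒≤ᵇ large , ≤⇒≤ᵇ heavy))

  -- Cardinalities

  term≤sum : ∀ {n} (f : Fin n → ℕ) i → f i ≤ sum f
  term≤sum f zero    = m≤m+n (f zero) _
  term≤sum f (suc i) = ≤-trans (term≤sum (f ∘ suc) i) (m≤n+m _ (f zero))

  _≟ᵇ_ : ∀ {n} → Fin n → Fin n → Bool
  i ≟ᵇ j = does (i Finₚ.≟ j)

  card-≟ : ∀ {n} (r : Fin n) → card (_≟ᵇ r) ≡ 1
  card-≟ {suc n} zero    = cong suc (sum-replicate-zero n)
  card-≟ {suc n} (suc r) = card-≟ r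

  card-true : ∀ n → card {n} (λ _ → true) ≡ n
  card-true zero    = refl
  card-true (suc n) = cong suc (card-true n)

  card-not : ∀ {n} (A : Fin n → Bool) → card A + card (not ∘ A) ≡ n
  card-not {zero}  A = refl
  card-not {suc n} A with A zero
  ... | true  = cong suc (card-not (A ∘ suc))
  ... | false = trans (+-suc (card (A ∘ suc)) _) (cong suc (card-not (A ∘ suc)))

  ∣S∣≡card : ∀ {n} (S : Subset n) → Subset.∣ S ∣ ≡ card (lookup S)
  ∣S∣≡card []          = refl
  ∣S∣≡card (true  ∷ S) = cong suc (∣S∣≡card S)
  ∣S∣≡card (false ∷ S) = ∣S∣≡card S

  sum-splitAt : ∀ m {n} (f : Fin m ⊎ Fin n → ℕ) → sum (f ∘ splitAt m) ≡ sum (f ∘ inj₁) + sum (f ∘ inj₂)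
  sum-splitAt zero    f = refl
  sum-splitAt (suc m) f = trans (cong (f (inj₁ zero) +_) (sum-splitAt m (f ∘ Sum.map₁ suc)))
    (sym (+-assoc (f (inj₁ zero)) _ _))

  sum-remQuot : ∀ w {t} (f : Fin t → ℕ) → sum (λ u → f (proj₂ (remQuot {w} t u))) ≡ w * sum f
  sum-remQuot zero    f = refl
  sum-remQuot (suc w) {t} f = trans (sum-cong-≗ unfold) (trans (sum-splitAt t g) (cong (sum f +_) (sum-remQuot w f)))
    where
    g : Fin t ⊎ Fin (w * t) → ℕ
    g (inj₁ j) = f j
    g (inj₂ u) = f (proj₂ (remQuot {w} t u))
    unfold : ∀ u → f (proj₂ (remQuot {suc w} t u)) ≡ g (splitAt t u)
    unfold u with splitAt t u
    ... | inj₁ _ = refl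
    ... | inj₂ _ = refl

  sum-inject≤ : ∀ {m n} (m≤n : m ≤ n) (f : Fin n → ℕ) → sum (λ u → f (inject≤ u m≤n)) ≤ sum f
  sum-inject≤ {zero}          m≤n       f = z≤n
  sum-inject≤ {suc m} {suc n} (s≤s m≤n) f = +-monoʳ-≤ (f zero) (sum-inject≤ m≤n (f ∘ suc))

  -- The parts are the residue classes modulo `t`: in `Fin (w * t)`, which contains `Fin n`, each
  -- residue occurs exactly `w` times.
  balanced-partition : ∀ n t .{{_ : NonZero t}} →
    ∃[ part ] ∀ x → card {n} (λ u → part u ≟ᵇ x) ≤ suc (n / t)
  balanced-partition n t = part , fiber≤
    where
    w = suc (n / t)
    n≤wt : n ≤ w * t
    n≤wt = ≤-trans (≤-reflexive (m≡m%n+[m/n]*n n t)) (+-monoˡ-≤ (n / t * t) (<⇒≤ (m%n<n n t)))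
    part : Fin n → Fin t
    part u = proj₂ (remQuot {w} t (inject≤ u n≤wt))
    fiber≤ : ∀ x → card (λ u → part u ≟ᵇ x) ≤ w
    fiber≤ x = ≤-trans (sum-inject≤ n≤wt (λ u → ind (proj₂ (remQuot {w} t u) ≟ᵇ x)))
      (≤-reflexive (trans (sum-remQuot w (λ y → ind (y ≟ᵇ x))) (trans (cong (w *_) (card-≟ x)) (*-identityʳ w))))

  -- Colorings without monochromatic paths of length two

  record PathFree (k t : ℕ) : Set where
    field
      color      : Fin t → Fin t → Fin k
      alternates : ∀ {x y z} → x ≢ y → y ≢ z → color x y ≢ color y z
  open PathFree

  -- Consecutive arcs have different tails.
  by-tail : ∀ t → PathFree t t
  by-tail t = record { color = λ x _ → x ; alternates = λ x≢y _ → x≢y }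

  -- A lexicographic product with disjoint palettes: pairs with equal first coordinates are colored
  -- by `G`, all others by `F`. Consecutive arcs of different kinds differ by palette, those of the
  -- same kind by the alternation of `F` or `G`.
  _⊗_ : ∀ {k l t u} → PathFree k t → PathFree l u → PathFree (k + l) (t * u)
  _⊗_ {k} {l} {t} {u} F G = record { color = col ; alternates = λ {x} {y} {z} → alt x y z }
    where
    hi : Fin (t * u) → Fin t
    hi x = proj₁ (remQuot {t} u x)
    lo : Fin (t * u) → Fin u
    lo x = proj₂ (remQuot {t} u x)
    col : Fin (t * u) → Fin (t * u) → Fin (k + l)
    col x y with hi x Finₚ.≟ hi y
    ... | yes _ = k ↑ʳ color G (lo x) (lo y)
    ... | no  _ = color F (hi x) (hi y) ↑ˡ l
    ↑ˡ≢↑ʳ : ∀ {i : Fin k} {j : Fin l} → i ↑ˡ l ≢ k ↑ʳ j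
    ↑ˡ≢↑ʳ {i} {j} eq with trans (sym (splitAt-↑ˡ k i l)) (trans (cong (splitAt k) eq) (splitAt-↑ʳ k l j))
    ... | ()
    lo≢ : ∀ {x y} → x ≢ y → hi x ≡ hi y → lo x ≢ lo y
    lo≢ {x} {y} x≢y hi≡ lo≡ = x≢y (trans (sym (combine-remQuot {t} u x))
      (trans (cong₂ combine hi≡ lo≡) (combine-remQuot {t} u y)))
    alt : ∀ x y z → x ≢ y → y ≢ z → col x y ≢ col y z
    alt x y z x≢y y≢z with hi x Finₚ.≟ hi y | hi y Finₚ.≟ hi z
    ... | yes p | yes q = alternates G (lo≢ x≢y p) (lo≢ y≢z q) ∘ ↑ʳ-injective k _ _
    ... | yes p | no ¬q = ↑ˡ≢↑ʳ ∘ sym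
    ... | no ¬p | yes q = ↑ˡ≢↑ʳ
    ... | no ¬p | no ¬q = alternates F ¬p ¬q ∘ ↑ˡ-injective l _ _

  -- parts k is the largest product of positive integers with sum k + 2.
  parts : ℕ → ℕ
  parts 0 = 2
  parts 1 = 3
  parts 2 = 4
  parts (suc (suc (suc k))) = 3 * parts k

  pathFree : ∀ k → PathFree (2 + k) (parts k)
  pathFree 0 = by-tail 2
  pathFree 1 = by-tail 3
  pathFree 2 = by-tail 4
  pathFree (suc (suc (suc k))) = by-tail 3 ⊗ pathFree k

  2≤parts : ∀ k → 2 ≤ parts k
  2≤parts 0 = s≤s (s≤s z≤n)
  2≤parts 1 = s≤s (s≤s z≤n)
  2≤parts 2 = s≤s (s≤s z≤n)
  2≤parts (suc (suc (suc k))) = ≤-trans (2≤parts k) (m≤m+n (parts k) _)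

  parts≢0 : ∀ k → NonZero (parts k)
  parts≢0 k = >-nonZero (<-trans (s≤s z≤n) (2≤parts k))

  module PartColoring {n k t} (F : PathFree k t) (part : Fin n → Fin t) where

    coloring : Coloring n (suc k)
    coloring u v with part u Finₚ.≟ part v
    ... | yes _ = zero
    ... | no  _ = suc (color F (part u) (part v))

    mono-path : ∀ u v w → coloring v w ≡ coloring u v → part u ≡ part v × part v ≡ part w
    mono-path u v w eq with part u Finₚ.≟ part v | part v Finₚ.≟ part w
    ... | yes p | yes q = p , q
    ... | no ¬p | no ¬q = contradiction (sym (Finₚ.suc-injective eq)) (alternates F ¬p ¬q)

    -- By `mono-path` the last two arcs on the way to a vertex below depth one stay in one part, and
    -- this repeats upwards until the root is reached. The recursion is on the depth label, since
    -- the parent map by itself provides no decreasing measure.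
    deep : ∀ {T : Tournament n} (A : Arborescence T) → PathMonochromatic coloring A →
      ∀ d v → depth A v ≡ d → v ∈ vertices A → v ≢ root A → parent A v ≢ root A → part v ≡ part (root A)
    deep A mono zero v d≡ v∈ v≢r p≢r with trans (sym d≡) (parentDepth A v v∈ v≢r)
    ... | ()
    deep A mono (suc d) v d≡ v∈ v≢r p≢r
      with p∈ ← parent∈ A v v∈ v≢r
      with pp≡p , p≡v ← mono-path (parent A (parent A v)) (parent A v) v (mono v v∈ v≢r p≢r)
      with parent A (parent A v) Finₚ.≟ root A
    ... | yes pp≡r = trans (sym p≡v) (trans (sym pp≡p) (cong part pp≡r))
    ... | no  pp≢r = trans (sym p≡v)
      (deep A mono d (parent A v) (suc-injective (trans (sym (parentDepth A v v∈ v≢r)) d≡)) p∈ p≢r pp≢r)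

    reach : ∀ {T : Tournament n} (A : Arborescence T) → PathMonochromatic coloring A →
      ∀ v → v ∈ vertices A → part v ≡ part (root A) ⊎ arc T (root A) v ≡ true
    reach {T} A mono v v∈ with v Finₚ.≟ root A
    ... | yes refl = inj₁ refl
    ... | no v≢r with parent A v Finₚ.≟ root A
    ...   | yes p≡r = inj₂ (subst (λ p → arc T p v ≡ true) p≡r (parentArc A v v∈ v≢r))
    ...   | no  p≢r = inj₁ (deep A mono (depth A v) v refl v∈ v≢r p≢r)

    inside outside : Fin n → Fin n → Bool
    inside  r v = part v ≟ᵇ part r
    outside r v = not (inside r v)

    -- By `reach`, a member outside the part of the root is an out-neighbour of the root. Their
    -- number is written as `edges` from a singleton so that `Heavy` applies to it.
    size-bound : ∀ (x : Code n) (A : Arborescence (tournament x)) → PathMonochromatic coloring A →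
      size A ≤ card (inside (root A)) + edges (_≟ᵇ root A) (outside (root A)) x
    size-bound x A mono = begin
      size A                                          ≡⟨ ∣S∣≡card (vertices A) ⟩
      card (lookup (vertices A))                      ≤⟨ sum-mono-≤ pointwise ⟩
      sum (λ v → ind (inside r v) + ind (outside r v ∧ arcs x r v)) ≡⟨ ∑-distrib-+ (ind ∘ inside r) _ ⟩
      card (inside r) + card (λ v → outside r v ∧ arcs x r v)       ≤⟨ +-monoʳ-≤ (card (inside r)) row ⟩
      card (inside r) + edges (_≟ᵇ r) (outside r) x   ∎
      where
      open ≤-Reasoning
      r = root A
      pointwise : ∀ v → ind (lookup (vertices A) v) ≤ ind (inside r v) + ind (outside r v ∧ arcs x r v)
      pointwise v with lookup (vertices A) v in eq
      ... | false = z≤n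
      ... | true with part v Finₚ.≟ part r
      ...   | yes _ = s≤s z≤n
      ...   | no ¬p with reach A mono v (lookup⇒[]= v (vertices A) eq)
      ...     | inj₁ p = contradiction p ¬p
      ...     | inj₂ a rewrite a = s≤s z≤n
      row : card (λ v → outside r v ∧ arcs x r v) ≤ edges (_≟ᵇ r) (outside r) x
      row = ≤-trans
        (≤-reflexive (sum-cong-≗ (λ v → cong (λ b → ind ((b ∧ outside r v) ∧ arcs x r v)) (sym (dec-true (r Finₚ.≟ r) refl)))))
        (term≤sum (λ i → card (λ v → ((i ≟ᵇ r) ∧ outside r v) ∧ arcs x i v)) r)

  -- The upper bound

  -- Four times the coefficient of `K` in `threshold c′ K`: once `density c′ * K ≤ n`, a family of
  -- n/4 pairs is large enough for the Chernoff bound.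
  density : ℕ → ℕ
  density c′ = suc (suc c′ + suc c′) * tiltV c′ * 4

  density≢0 : ∀ c′ → NonZero (density c′)
  density≢0 c′ = m*n≢0 _ 4 {{m*n≢0 (suc (suc c′ + suc c′)) (tiltV c′) {{_}} {{tiltV≢0 c′}}}}

  threshold≤ : ∀ c′ K {n b} → density c′ * K ≤ n → n ≤ 4 * b → threshold c′ K ≤ b
  threshold≤ c′ K {n} {b} large n≤4b = *-cancelˡ-≤ 4
    (≤-trans (≤-reflexive (swap (suc (suc c′ + suc c′)) (tiltV c′) K)) (≤-trans large n≤4b))
    where
    swap : ∀ x y z → 4 * (x * (y * z)) ≡ x * y * 4 * z
    swap = solve-∀

  enough : ℕ → ℕ → ℕ
  enough c′ j = density c′ * 2 * (j * (density c′ * 2))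

  -- Divided by 2tcn, the bound reads m/n ≤ 1/2 + 1/(2t) + 1/c. The last term absorbs the bias of
  -- the Chernoff bound and the rounding of the part sizes. There is one event for each possible
  -- root.
  upper-with : ∀ k c′ j n K → density c′ * K ≤ n → j * n ≤ 2 ^ K → suc c′ + 4 ≤ n →
    (part : Fin n → Fin (parts k)) → (∀ x → card (λ u → part u ≟ᵇ x) ≤ suc ((n / parts k) {{parts≢0 k}})) →
    AlmostAll n j (λ T → ∀ m → HasPMA∞ T (3 + k) m →
      2 * parts k * suc c′ * m ≤ (parts k * suc c′ + suc c′ + 2 * parts k) * n)
  upper-with k c′ j n K MK≤n jn≤2^K c+4≤n part part≤ = union-bound j Es rare bounded
    where
    open PartColoring (pathFree k) part
    open ≤-Reasoning
    t = parts k
    c = suc c′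
    instance
      t≢0 : NonZero t
      t≢0 = parts≢0 k
    E : Fin n → Code n → Bool
    E r = Heavy c′ K (_≟ᵇ r) (outside r)
    Es = List.map E (allFin n)
    ∣Es∣≡n : length Es ≡ n
    ∣Es∣≡n = trans (length-map E (allFin n)) (length-tabulate (λ i → i))
    disjoint : ∀ r i → (i ≟ᵇ r) ∧ outside r i ≡ false
    disjoint r i with i Finₚ.≟ r
    ... | no  _    = refl
    ... | yes refl = cong not (dec-true (part i Finₚ.≟ part i) refl)
    rare : j * occurrences Es ≤ 2 ^ pairs n
    rare = rare-family K j Es (subst (λ z → j * z ≤ 2 ^ K) (sym ∣Es∣≡n) jn≤2^K)
      (Allₚ.map⁺ (All.tabulate (λ {r} _ → heavy-rare c′ K (_≟ᵇ r) (outside r) (disjoint r))))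
    bounded : ∀ x → Avoids Es x → ∀ m → HasPMA∞ (tournament x) (3 + k) m →
      2 * t * c * m ≤ (t * c + c + 2 * t) * n
    bounded x avoids m has with A , mono , m≤∣A∣ ← has coloring = begin
      2 * t * c * m                          ≤⟨ *-monoʳ-≤ (2 * t * c) (≤-trans m≤∣A∣ (size-bound x A mono)) ⟩
      -- The added slack turns 2c into 2c + 1, the denominator of the density in `Heavy`.
      2 * t * c * (p + e)                    ≤⟨ m≤m+n _ (t * (p + e)) ⟩
      2 * t * c * (p + e) + t * (p + e)      ≡⟨ ring₁ t c p e ⟩
      t * (suc (c + c) * p + suc (c + c) * e) ≤⟨ *-monoʳ-≤ t (+-monoʳ-≤ (suc (c + c) * p) (<⇒≤ light)) ⟩
      t * (suc (c + c) * p + suc c * (card (_≟ᵇ r) * b)) ≡⟨ cong (λ z → t * (suc (c + c) * p + suc c * (z * b))) (card-≟ r) ⟩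
      t * (suc (c + c) * p + suc c * (1 * b)) ≡⟨ ring₂ t c p b ⟩
      t * suc c * (p + b) + c * (t * p)      ≡⟨ cong (λ z → t * suc c * z + c * (t * p)) p+b≡n ⟩
      t * suc c * n + c * (t * p)            ≤⟨ +-monoʳ-≤ (t * suc c * n) (*-monoʳ-≤ c tp≤) ⟩
      t * suc c * n + c * (t + n)            ≡⟨ ring₃ t c n ⟩
      (t * c + c + t) * n + t * c            ≤⟨ +-monoʳ-≤ ((t * c + c + t) * n) (*-monoʳ-≤ t (m+n≤o⇒m≤o c c+4≤n)) ⟩
      (t * c + c + t) * n + t * n            ≡⟨ ring₄ t c n ⟩
      (t * c + c + 2 * t) * n                ∎
      where
      r = root A
      p = card (inside r)
      b = card (outside r)
      e = edges (_≟ᵇ r) (outside r) x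
      p+b≡n : p + b ≡ n
      p+b≡n = card-not (inside r)
      tp≤ : t * p ≤ t + n
      tp≤ = begin
        t * p             ≤⟨ *-monoʳ-≤ t (part≤ (part r)) ⟩
        t * suc (n / t)   ≡⟨ *-comm t (suc (n / t)) ⟩
        t + n / t * t     ≤⟨ +-monoʳ-≤ t (m/n*n≤m n t) ⟩
        t + n             ∎
      2p≤ : 2 * p ≤ 2 + n
      2p≤ = begin
        2 * p             ≤⟨ *-monoʳ-≤ 2 (part≤ (part r)) ⟩
        2 * suc (n / t)   ≡⟨ *-suc 2 (n / t) ⟩
        2 + 2 * (n / t)   ≤⟨ +-monoʳ-≤ 2 (*-monoˡ-≤ (n / t) (2≤parts k)) ⟩
        2 + t * (n / t)   ≡⟨ cong (2 +_) (*-comm t (n / t)) ⟩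
        2 + n / t * t     ≤⟨ +-monoʳ-≤ 2 (m/n*n≤m n t) ⟩
        2 + n             ∎
      -- As there are at least two parts, b ≥ n/2 - 1, and this is at least n/4 because n ≥ 4.
      n≤4b : n ≤ 4 * b
      n≤4b = +-cancelˡ-≤ (4 + 2 * n + n) _ _ (begin
        4 + 2 * n + n + n       ≤⟨ +-monoˡ-≤ n (+-monoˡ-≤ n (+-monoˡ-≤ (2 * n) (m+n≤o⇒n≤o c c+4≤n))) ⟩
        n + 2 * n + n + n       ≡⟨ cong (λ n → n + 2 * n + n + n) (sym p+b≡n) ⟩
        (p + b) + 2 * (p + b) + (p + b) + (p + b) ≡⟨ ring₅ p b ⟩
        2 * (2 * p) + (p + b) + 4 * b             ≤⟨ +-monoˡ-≤ (4 * b) (+-monoˡ-≤ (p + b) (*-monoʳ-≤ 2 2p≤)) ⟩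
        2 * (2 + n) + (p + b) + 4 * b             ≡⟨ cong₂ (λ x y → x + y + 4 * b) (*-distribˡ-+ 2 2 n) p+b≡n ⟩
        4 + 2 * n + n + 4 * b   ∎)
        where
        ring₅ : ∀ p b → (p + b) + 2 * (p + b) + (p + b) + (p + b) ≡ 2 * (2 * p) + (p + b) + 4 * b
        ring₅ = solve-∀
      light : suc (c + c) * e < suc c * (card (_≟ᵇ r) * b)
      light = not-heavy c′ K (_≟ᵇ r) (outside r) x (All.lookup avoids (∈-map⁺ E (∈-allFin r)))
        (subst (threshold c′ K ≤_) (trans (sym (+-identityʳ b)) (cong (_* b) (sym (card-≟ r)))) (threshold≤ c′ K MK≤n n≤4b))
      ring₁ : ∀ t c p e → 2 * t * c * (p + e) + t * (p + e) ≡ t * (suc (c + c) * p + suc (c + c) * e)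
      ring₁ = solve-∀
      ring₂ : ∀ t c p b → t * (suc (c + c) * p + suc c * (1 * b)) ≡ t * suc c * (p + b) + c * (t * p)
      ring₂ = solve-∀
      ring₃ : ∀ t c n → t * suc c * n + c * (t + n) ≡ (t * c + c + t) * n + t * c
      ring₃ = solve-∀
      ring₄ : ∀ t c n → (t * c + c + t) * n + t * n ≡ (t * c + c + 2 * t) * n
      ring₄ = solve-∀

  upper : ∀ k c′ j n → enough c′ j + (suc c′ + 4) ≤ n → AlmostAll n j (λ T → ∀ m → HasPMA∞ T (3 + k) m →
    2 * parts k * suc c′ * m ≤ (parts k * suc c′ + suc c′ + 2 * parts k) * n)
  upper k c′ j n large =
    let K , MK≤n , jn≤2^K = linear-exponent (density c′) {{density≢0 c′}} j n (m+n≤o⇒m≤o _ large)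
        part , part≤ = balanced-partition n (parts k) {{parts≢0 k}}
    in upper-with k c′ j n K MK≤n jn≤2^K (m+n≤o⇒n≤o (enough c′ j) large) part part≤

  -- A vertex with many arcs of one color on both sides

  card-split : ∀ {n} (A B : Fin n → Bool) → card (λ i → A i ∧ B i) + card (λ i → A i ∧ not (B i)) ≡ card A
  card-split A B = sum-+-cong (λ i → ind-split (A i) (B i))

  sum-bound : ∀ {n} (U : Fin n → Bool) (g : Fin n → ℕ) s b → (∀ u → U u ≡ true → s * g u ≤ b) →
    s * sum (λ u → ind (U u) * g u) ≤ card U * b
  sum-bound U g s b h = begin
    s * sum (λ u → ind (U u) * g u)     ≡⟨ *-distribˡ-sum s (λ u → ind (U u) * g u) ⟩
    sum (λ u → s * (ind (U u) * g u))   ≤⟨ sum-mono-≤ pointwise ⟩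
    sum (λ u → ind (U u) * b)           ≡⟨ sym (*-distribʳ-sum b (ind ∘ U)) ⟩
    card U * b                          ∎
    where
    open ≤-Reasoning
    pointwise : ∀ u → s * (ind (U u) * g u) ≤ ind (U u) * b
    pointwise u with U u in eq
    ... | true  = subst₂ _≤_ (cong (s *_) (sym (+-identityʳ (g u)))) (sym (+-identityʳ b)) (h u eq)
    ... | false = ≤-reflexive (*-zeroʳ s)

  -- Iterating over the colors, keep the larger of the two halves.
  homogeneous : ∀ {n k} (P Q : Fin k → Fin n → Set) → (∀ i v → Dec (P i v)) → (∀ i v → ¬ P i v → Q i v) →
    (is : List (Fin k)) → ∃[ U ] (n ≤ 2 ^ length is * card U ×
      All (λ i → (∀ v → U v ≡ true → P i v) ⊎ (∀ v → U v ≡ true → Q i v)) is)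
  homogeneous {n} P Q P? Q-rest [] = (λ _ → true) , ≤-reflexive (sym (trans (+-identityʳ _) (card-true n))) , []
  homogeneous {n} P Q P? Q-rest (i ∷ is) with homogeneous P Q P? Q-rest is
  ... | U , n≤ , hom = choose (≤-total (card U₂) (card U₁))
    where
    open ≤-Reasoning
    S : Fin n → Bool
    S v = does (P? i v)
    U₁ U₂ : Fin n → Bool
    U₁ v = U v ∧ S v
    U₂ v = U v ∧ not (S v)
    ∧-elimˡ : ∀ {a b} → a ∧ b ≡ true → a ≡ true
    ∧-elimˡ {true} _ = refl
    U₁⇒P : ∀ v → U₁ v ≡ true → P i v
    U₁⇒P v h with P? i v
    ... | yes p = p
    ... | no  _ with () ← trans (sym h) (∧-zeroʳ (U v))
    U₂⇒Q : ∀ v → U₂ v ≡ true → Q i v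
    U₂⇒Q v h with P? i v
    ... | no ¬p = Q-rest i v ¬p
    ... | yes _ with () ← trans (sym h) (∧-zeroʳ (U v))
    restrict : ∀ {U′ : Fin n → Bool} → (∀ {v} → U′ v ≡ true → U v ≡ true) →
      All (λ i → (∀ v → U′ v ≡ true → P i v) ⊎ (∀ v → U′ v ≡ true → Q i v)) is
    restrict sub = All.map (Sum.map (λ f v → f v ∘ sub) (λ f v → f v ∘ sub)) hom
    halve : ∀ {a b} → a + b ≡ card U → b ≤ a → n ≤ 2 ^ suc (length is) * a
    halve {a} {b} a+b≡ b≤a = begin
      n                           ≤⟨ n≤ ⟩
      2 ^ length is * card U      ≡⟨ cong (2 ^ length is *_) (sym a+b≡) ⟩
      2 ^ length is * (a + b)     ≤⟨ *-monoʳ-≤ (2 ^ length is) (+-monoʳ-≤ a b≤a) ⟩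
      2 ^ length is * (a + a)     ≡⟨ ring (2 ^ length is) a ⟩
      2 * 2 ^ length is * a       ∎
      where
      ring : ∀ x a → x * (a + a) ≡ 2 * x * a
      ring = solve-∀
    choose : card U₂ ≤ card U₁ ⊎ card U₁ ≤ card U₂ → _
    choose (inj₁ le) = U₁ , halve (card-split U S) le , inj₁ U₁⇒P ∷ restrict ∧-elimˡ
    choose (inj₂ le) = U₂ , halve (trans (+-comm (card U₂) _) (card-split U S)) le , inj₂ U₂⇒Q ∷ restrict ∧-elimˡ

  module Colored {n k} (x : Code n) (c : Coloring n k) where

    outOf inTo : Fin k → Fin n → Fin n → Bool
    outOf i v w = arcs x v w ∧ (c v w ≟ᵇ i)
    inTo  i v u = arcs x u v ∧ (c u v ≟ᵇ i)

    module _ (U : Fin n → Bool) where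

      inside₂ : Fin n → Fin n → Bool
      inside₂ u w = U u ∧ (U w ∧ arcs x u w)

      -- A product of indicators, so that the factor of the tail or of the head can be taken out of
      -- the inner sum.
      ofColor : Fin k → ℕ
      ofColor i = sum (λ u → sum (λ w → ind (U u) * (ind (U w) * ind (outOf i u w))))

      drop-U : ∀ b m → ind b * m ≤ m
      drop-U true  m = ≤-reflexive (+-identityʳ m)
      drop-U false m = z≤n

      ofColor-out : ∀ i → ofColor i ≤ sum (λ u → ind (U u) * card (outOf i u))
      ofColor-out i = sum-mono-≤ λ u → ≤-trans
        (≤-reflexive (sym (*-distribˡ-sum (ind (U u)) (λ w → ind (U w) * ind (outOf i u w)))))
        (*-monoʳ-≤ (ind (U u)) (sum-mono-≤ (λ w → drop-U (U w) _)))

      ofColor-in : ∀ i → ofColor i ≤ sum (λ w → ind (U w) * card (inTo i w))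
      ofColor-in i = ≤-trans (≤-reflexive (∑-comm (λ u w → ind (U u) * (ind (U w) * ind (outOf i u w)))))
        (sum-mono-≤ λ w → ≤-trans (sum-mono-≤ (λ u → drop-U (U u) _))
          (≤-reflexive (sym (*-distribˡ-sum (ind (U w)) (ind ∘ inTo i w)))))

      inside₂-ofColor : card₂ inside₂ ≤ sum ofColor
      inside₂-ofColor = begin
        card₂ inside₂                                ≤⟨ sum-mono-≤ (λ u → sum-mono-≤ (λ w → pointwise u w)) ⟩
        sum (λ u → sum (λ w → sum (λ i → f u w i)))  ≡⟨ sum-cong-≗ (λ u → ∑-comm (f u)) ⟩
        sum (λ u → sum (λ i → sum (λ w → f u w i)))  ≡⟨ ∑-comm (λ u i → sum (λ w → f u w i)) ⟩
        sum ofColor                                  ∎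
        where
        open ≤-Reasoning
        f : Fin n → Fin n → Fin k → ℕ
        f u w i = ind (U u) * (ind (U w) * ind (outOf i u w))
        pointwise : ∀ u w → ind (inside₂ u w) ≤ sum (f u w)
        pointwise u w = ≤-trans (≤-reflexive (trans (ind-∧ (U u) _) (cong (ind (U u) *_) (trans (ind-∧ (U w) _)
            (cong (λ b → ind (U w) * ind b) (trans (sym (∧-identityʳ (arcs x u w)))
              (cong (arcs x u w ∧_) (sym (dec-true (c u w Finₚ.≟ c u w) refl)))))))))
          (term≤sum (f u w) (c u w))

      -- An ordered pair of vertices of `U` is an arc, the reverse of an arc, or diagonal.
      inside₂-square : card U * card U ≤ card₂ inside₂ + card₂ inside₂ + card U
      inside₂-square = begin
        card U * card U                         ≡⟨ sym (card₂-× U U) ⟩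
        card₂ (λ u w → U u ∧ U w)               ≤⟨ sum-mono-≤ (λ u → sum-mono-≤ (λ w → pointwise u w)) ⟩
        sum (λ u → sum (λ w → g u w + g w u + h u w)) ≡⟨ sum-cong-≗ (λ u → trans (∑-distrib-+ (λ w → g u w + g w u) (h u)) (cong (_+ sum (h u)) (∑-distrib-+ (g u) (λ w → g w u)))) ⟩
        sum (λ u → sum (g u) + sum (λ w → g w u) + sum (h u)) ≡⟨ trans (∑-distrib-+ (λ u → sum (g u) + sum (λ w → g w u)) (sum ∘ h)) (cong (_+ sum (sum ∘ h)) (∑-distrib-+ (sum ∘ g) (λ u → sum (λ w → g w u)))) ⟩
        sum (sum ∘ g) + sum (λ u → sum (λ w → g w u)) + sum (sum ∘ h) ≡⟨ cong₂ (λ y z → sum (sum ∘ g) + y + z) (∑-comm (λ u w → g w u)) diagonal ⟩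
        card₂ inside₂ + card₂ inside₂ + card U  ∎
        where
        open ≤-Reasoning
        g h : Fin n → Fin n → ℕ
        g u w = ind (inside₂ u w)
        h u w = ind (U u) * ind (w ≟ᵇ u)
        diagonal : sum (sum ∘ h) ≡ card U
        diagonal = sum-cong-≗ λ u → trans (sym (*-distribˡ-sum (ind (U u)) (λ w → ind (w ≟ᵇ u))))
          (trans (cong (ind (U u) *_) (card-≟ u)) (*-identityʳ (ind (U u))))
        pointwise : ∀ u w → ind (U u ∧ U w) ≤ g u w + g w u + h u w
        pointwise u w with w Finₚ.≟ u
        ... | yes refl with U w
        ...   | true  = m≤n+m 1 _
        ...   | false = z≤n
        pointwise u w | no w≢u with arcs x u w in uw | arcs x w u in wu
        ... | true  | _ with U u | U w
        ...   | true  | true  = s≤s z≤n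
        ...   | true  | false = z≤n
        ...   | false | _     = z≤n
        pointwise u w | no w≢u | false | true with U u | U w
        ... | true  | true  = s≤s z≤n
        ... | true  | false = z≤n
        ... | false | _     = z≤n
        pointwise u w | no w≢u | false | false
          with () ← trans (sym (total (tournament x) w u w≢u wu)) uw

    -- If there were no such vertex, take `U` homogeneous for every color, with z ≥ n/2^k vertices.
    -- Each color would have at most zn/s arcs inside `U`, and for the chosen `s` all colors
    -- together would be too few for the roughly z²/2 arcs of a tournament on `U`.
    rich-vertex : ∀ {s} → s ≡ 4 * k * 2 ^ k → .{{_ : NonZero k}} → 2 * 2 ^ k < n →
      ∃[ v ] ∃[ i ] (n ≤ s * card (inTo i v) × n ≤ s * card (outOf i v))
    rich-vertex {s} s≡ large
      with any? (λ v → any? (λ i → (n ≤? s * card (inTo i v)) ×-dec (n ≤? s * card (outOf i v))))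
    ... | yes found = found
    ... | no ¬found
      with U , n≤ , hom ← homogeneous (λ i v → n ≤ s * card (inTo i v)) (λ i v → s * card (inTo i v) < n)
                            (λ i v → n ≤? s * card (inTo i v)) (λ i v → ≰⇒>) (allFin k)
      = contradiction n≤2·2^k (<⇒≱ large)
      where
      open ≤-Reasoning
      z = card U
      n≤2^kz : n ≤ 2 ^ k * z
      n≤2^kz = subst (λ l → n ≤ 2 ^ l * z) (length-tabulate {n = k} (λ i → i)) n≤
      instance
        z≢0 : NonZero z
        z≢0 = ≢-nonZero λ z≡0 → <⇒≱ (≤-<-trans z≤n large)
          (≤-trans n≤2^kz (≤-reflexive (trans (cong (2 ^ k *_) z≡0) (*-zeroʳ (2 ^ k)))))
      -- If the vertices of `U` have many incoming arcs of color `i`, they have few outgoing ones by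
      -- `¬found`, and the arcs are counted by tail. Otherwise they are counted by head.
      color≤ : ∀ i → s * ofColor U i ≤ z * n
      color≤ i with All.lookup hom (∈-allFin i)
      ... | inj₁ in-large = ≤-trans (*-monoʳ-≤ s (ofColor-out U i))
        (sum-bound U (card ∘ outOf i) s n (λ u u∈ → <⇒≤ (≰⇒> (λ out-large → ¬found (u , i , in-large u u∈ , out-large)))))
      ... | inj₂ in-small = ≤-trans (*-monoʳ-≤ s (ofColor-in U i))
        (sum-bound U (card ∘ inTo i) s n (λ u u∈ → <⇒≤ (in-small u u∈)))
      sum-const : ∀ {m} b (f : Fin m → ℕ) → (∀ i → f i ≤ b) → sum f ≤ m * b
      sum-const {zero}  b f f≤ = z≤n
      sum-const {suc m} b f f≤ = +-mono-≤ (f≤ zero) (sum-const b (f ∘ suc) (f≤ ∘ suc))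
      arcs≤ : s * card₂ (inside₂ U) ≤ k * (z * n)
      arcs≤ = begin
        s * card₂ (inside₂ U)           ≤⟨ *-monoʳ-≤ s (inside₂-ofColor U) ⟩
        s * sum (ofColor U)             ≡⟨ *-distribˡ-sum s (ofColor U) ⟩
        sum (λ i → s * ofColor U i)     ≤⟨ sum-const (z * n) _ color≤ ⟩
        k * (z * n)                     ∎
      sz≤ : s * z ≤ 2 * (k * n) + s
      sz≤ = *-cancelʳ-≤ _ _ z (begin
        s * z * z                                    ≡⟨ *-assoc s z z ⟩
        s * (z * z)                                  ≤⟨ *-monoʳ-≤ s (inside₂-square U) ⟩
        s * (e + e + z)                              ≡⟨ ring₁ s e z ⟩
        2 * (s * e) + s * z                          ≤⟨ +-monoˡ-≤ (s * z) (*-monoʳ-≤ 2 arcs≤) ⟩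
        2 * (k * (z * n)) + s * z                    ≡⟨ ring₂ s k z n ⟩
        (2 * (k * n) + s) * z                        ∎)
        where
        e = card₂ (inside₂ U)
        ring₁ : ∀ s e z → s * (e + e + z) ≡ 2 * (s * e) + s * z
        ring₁ = solve-∀
        ring₂ : ∀ s k z n → 2 * (k * (z * n)) + s * z ≡ (2 * (k * n) + s) * z
        ring₂ = solve-∀
      -- The value of `s` makes `s * z` at least 4kn, twice the linear term in `sz≤`. The other half
      -- must fit into `s` itself.
      n≤2·2^k : n ≤ 2 * 2 ^ k
      n≤2·2^k = *-cancelˡ-≤ k (*-cancelˡ-≤ 2 (+-cancelˡ-≤ (2 * (k * n)) _ _ (begin
        2 * (k * n) + 2 * (k * n)        ≡⟨ ring₃ k n ⟩
        4 * k * n                        ≤⟨ *-monoʳ-≤ (4 * k) n≤2^kz ⟩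
        4 * k * (2 ^ k * z)              ≡⟨ sym (*-assoc (4 * k) (2 ^ k) z) ⟩
        4 * k * 2 ^ k * z                ≡⟨ cong (_* z) (sym s≡) ⟩
        s * z                            ≤⟨ sz≤ ⟩
        2 * (k * n) + s                  ≡⟨ cong (2 * (k * n) +_) (trans s≡ (ring₄ k (2 ^ k))) ⟩
        2 * (k * n) + 2 * (k * (2 * 2 ^ k)) ∎)))
        where
        ring₃ : ∀ k n → 2 * (k * n) + 2 * (k * n) ≡ 4 * k * n
        ring₃ = solve-∀
        ring₄ : ∀ k x → 4 * k * x ≡ 2 * (k * (2 * x))
        ring₄ = solve-∀

  -- The lower bound

  -- The arborescence r → N⁺(r), r → v → O.
  module Broom {n} (T : Tournament n) (r v : Fin n) (O : Fin n → Bool)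
    (rv : arc T r v ≡ true) (vO : ∀ {w} → O w ≡ true → arc T v w ≡ true) where

    member : Fin n → Bool
    member w = (w ≟ᵇ r) ∨ (arc T r w ∨ O w)

    set : Subset n
    set = tabulate member

    to∈ : ∀ {w} → member w ≡ true → w ∈ set
    to∈ {w} h = lookup⇒[]= w set (trans (lookup∘tabulate member w) h)

    from∈ : ∀ {w} → w ∈ set → member w ≡ true
    from∈ {w} h = trans (sym (lookup∘tabulate member w)) ([]=⇒lookup h)

    r∈ : member r ≡ true
    r∈ = cong (_∨ (arc T r r ∨ O r)) (dec-true (r Finₚ.≟ r) refl)

    v∈ : member v ≡ true
    v∈ = trans (cong (λ b → (v ≟ᵇ r) ∨ (b ∨ O v)) rv) (∨-zeroʳ (v ≟ᵇ r))

    v≢r : v ≢ r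
    v≢r refl with () ← trans (sym rv) (irrefl T r)

    -- A vertex in both N⁺(r) and `O` hangs from `r`. Thus arcs leaving `r` may have any color, and
    -- only r → v → O has to be monochromatic.
    par : Fin n → Fin n
    par w = if arc T r w then r else v

    lvl : Fin n → ℕ
    lvl w = if w ≟ᵇ r then 0 else if arc T r w then 1 else 2

    lvl-r : lvl r ≡ 0
    lvl-r = cong (λ b → if b then 0 else if arc T r r then 1 else 2) (dec-true (r Finₚ.≟ r) refl)

    lvl-v : lvl v ≡ 1
    lvl-v = cong₂ (λ b b′ → if b then 0 else if b′ then 1 else 2) (dec-false (v Finₚ.≟ r) v≢r) rv

    inner : ∀ {w} → w ≢ r → arc T r w ≡ false → member w ≡ true → O w ≡ true
    inner {w} w≢r ¬rw h = trans (sym (cong₂ (λ b b′ → b ∨ (b′ ∨ O w)) (dec-false (w Finₚ.≟ r) w≢r) ¬rw)) h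

    par-member : ∀ w → member (par w) ≡ true
    par-member w with arc T r w
    ... | true  = r∈
    ... | false = v∈

    par-arc : ∀ w → member w ≡ true → w ≢ r → arc T (par w) w ≡ true
    par-arc w h w≢r with arc T r w in rw
    ... | true  = rw
    ... | false = vO (trans (sym (cong (λ b → b ∨ O w) (dec-false (w Finₚ.≟ r) w≢r))) h)

    par-lvl : ∀ w → w ≢ r → lvl w ≡ suc (lvl (par w))
    par-lvl w w≢r = trans (cong (λ b → if b then 0 else if arc T r w then 1 else 2) (dec-false (w Finₚ.≟ r) w≢r)) (go (arc T r w))
      where
      go : ∀ b → (if b then 1 else 2) ≡ suc (lvl (if b then r else v))
      go true  = cong suc (sym lvl-r)
      go false = cong suc (sym lvl-v)

    broom : Arborescence T
    broom = record
      { vertices = set ; root = r ; parent = par ; depth = lvl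
      ; root∈ = to∈ r∈ ; rootDepth = lvl-r
      ; parent∈ = λ w _ _ → to∈ (par-member w)
      ; parentArc = λ w w∈ w≢r → par-arc w (from∈ w∈) w≢r
      ; parentDepth = λ w _ → par-lvl w }

    broom-mono : ∀ {k} (c : Coloring n k) i → c r v ≡ i → (∀ {w} → O w ≡ true → c v w ≡ i) → PathMonochromatic c broom
    broom-mono c i crv cvO w w∈ w≢r p≢r with arc T r w in rw
    ... | true  = contradiction refl p≢r
    ... | false rewrite rv = trans (cvO (inner w≢r rw (from∈ w∈))) (sym crv)

    broom-depth : DepthAtMost 2 broom
    broom-depth w _ with w ≟ᵇ r | arc T r w
    ... | true  | _     = z≤n
    ... | false | true  = s≤s z≤n
    ... | false | false = s≤s (s≤s z≤n)

    broom-size : O r ≡ false → 1 + card (arc T r) + card (λ w → O w ∧ not (arc T r w)) ≤ size broom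
    broom-size Or = begin
      1 + card (arc T r) + card (λ w → O w ∧ not (arc T r w))
        ≡⟨ cong (λ z → z + card (arc T r) + card (λ w → O w ∧ not (arc T r w))) (sym (card-≟ r)) ⟩
      card (_≟ᵇ r) + card (arc T r) + card (λ w → O w ∧ not (arc T r w))
        ≡⟨ cong (_+ card (λ w → O w ∧ not (arc T r w))) (sym (∑-distrib-+ (ind ∘ (_≟ᵇ r)) (ind ∘ arc T r))) ⟩
      sum (λ w → ind (w ≟ᵇ r) + ind (arc T r w)) + card (λ w → O w ∧ not (arc T r w))
        ≡⟨ sym (∑-distrib-+ (λ w → ind (w ≟ᵇ r) + ind (arc T r w)) _) ⟩
      sum (λ w → ind (w ≟ᵇ r) + ind (arc T r w) + ind (O w ∧ not (arc T r w)))
        ≤⟨ sum-mono-≤ pointwise ⟩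
      card member
        ≡⟨ sum-cong-≗ (λ w → cong ind (sym (lookup∘tabulate member w))) ⟩
      card (lookup set)
        ≡⟨ sym (∣S∣≡card set) ⟩
      size broom ∎
      where
      open ≤-Reasoning
      pointwise : ∀ w → ind (w ≟ᵇ r) + ind (arc T r w) + ind (O w ∧ not (arc T r w)) ≤ ind (member w)
      pointwise w with w Finₚ.≟ r
      ... | yes refl rewrite irrefl T w | Or = s≤s z≤n
      ... | no _ with arc T r w | O w
      ...   | true  | true  = s≤s z≤n
      ...   | true  | false = s≤s z≤n
      ...   | false | true  = s≤s z≤n
      ...   | false | false = z≤n

  edges-cong : ∀ {n} {A A′ B B′ : Fin n → Bool} (x : Code n) → (∀ i → A i ≡ A′ i) → (∀ i → B i ≡ B′ i) →
    edges A B x ≡ edges A′ B′ x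
  edges-cong x A≡ B≡ = sum-cong-≗ λ i → sum-cong-≗ λ j → cong₂ (λ a b → ind ((a ∧ b) ∧ arcs x i j)) (A≡ i) (B≡ j)

  average : ∀ {n} (x : Code n) (A B : Fin n → Bool) → 3 * edges A B x < 2 * (card A * card B) →
    ∃[ r ] (A r ≡ true × 3 * card (λ w → B w ∧ arcs x r w) < 2 * card B)
  average x A B light with any? (λ r → (A r Boolₚ.≟ true) ×-dec (3 * card (λ w → B w ∧ arcs x r w) <? 2 * card B))
  ... | yes found = found
  ... | no ¬found = contradiction light (≤⇒≯ (begin
    2 * (card A * card B)                            ≡⟨ swap (card A) (card B) ⟩
    card A * (2 * card B)                            ≡⟨ *-distribʳ-sum (2 * card B) (ind ∘ A) ⟩
    sum (λ r → ind (A r) * (2 * card B))             ≤⟨ sum-mono-≤ pointwise ⟩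
    sum (λ r → 3 * card (λ w → (A r ∧ B w) ∧ arcs x r w)) ≡⟨ sym (*-distribˡ-sum 3 (λ r → card (λ w → (A r ∧ B w) ∧ arcs x r w))) ⟩
    3 * edges A B x                                  ∎))
    where
    open ≤-Reasoning
    swap : ∀ a b → 2 * (a * b) ≡ a * (2 * b)
    swap = solve-∀
    pointwise : ∀ r → ind (A r) * (2 * card B) ≤ 3 * card (λ w → (A r ∧ B w) ∧ arcs x r w)
    pointwise r with A r in eq
    ... | true  = ≤-trans (≤-reflexive (+-identityʳ _)) (≮⇒≥ (λ small → ¬found (r , eq , small)))
    ... | false = z≤n

  -- The witness is ⌈X/D⌉. It yields one `m` valid for all colorings at once, although the size of
  -- the tree depends on the coloring.
  ceiling : ∀ X D .{{_ : NonZero D}} → ∃[ m ] (X ≤ D * m × (∀ z → X ≤ D * z → m ≤ z))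
  ceiling zero    D = 0 , z≤n , λ _ _ → z≤n
  ceiling (suc X) D with ceiling X D
  ... | m , X≤Dm , least with suc X ≤? D * m
  ...   | yes X<Dm = m , X<Dm , λ z X<Dz → least z (<⇒≤ X<Dz)
  ...   | no  X≮Dm = suc m
    , ≤-trans (+-mono-≤ (>-nonZero⁻¹ D) X≤Dm) (≤-reflexive (sym (*-suc D m)))
    , λ z X<Dz → ≤∧≢⇒< (least z (<⇒≤ X<Dz)) (λ { refl → X≮Dm X<Dz })

  -- The absence of heavy events gives only upper bounds on arc counts, so the out-degree is bounded
  -- below through the in-degree.
  out-degree : ∀ c′ K {n} (x : Code n) r → Heavy c′ K (not ∘ (_≟ᵇ r)) (_≟ᵇ r) x ≡ false →
    density c′ * K ≤ n → 2 ≤ n → suc c′ * n ≤ suc (suc c′ + suc c′) * (1 + card (arcs x r))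
  out-degree c′ K {n} x r light MK≤n 2≤n = +-cancelʳ-≤ (suc c * n) _ _ (begin
    c * n + suc c * n                                 ≡⟨ ring₁ c n ⟩
    suc (c + c) * n                                   ≤⟨ *-monoʳ-≤ (suc (c + c)) n≤ ⟩
    suc (c + c) * (1 + od + indeg)                    ≡⟨ *-distribˡ-+ (suc (c + c)) (1 + od) indeg ⟩
    suc (c + c) * (1 + od) + suc (c + c) * indeg      ≤⟨ +-monoʳ-≤ (suc (c + c) * (1 + od)) few ⟩
    suc (c + c) * (1 + od) + suc c * n                ∎)
    where
    open ≤-Reasoning
    c = suc c′
    od = card (arcs x r)
    indeg = card (λ i → arcs x i r)
    b = card (not ∘ (_≟ᵇ r))
    1+b≡n : 1 + b ≡ n
    1+b≡n = trans (cong (_+ b) (sym (card-≟ r))) (card-not (_≟ᵇ r))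
    b*1≡b : b * card (_≟ᵇ r) ≡ b
    b*1≡b = trans (cong (b *_) (card-≟ r)) (*-identityʳ b)
    n≤4b : n ≤ 4 * b
    n≤4b = +-cancelʳ-≤ 2 _ _ (begin
      n + 2           ≤⟨ +-monoʳ-≤ n 2≤n ⟩
      n + n           ≡⟨ cong₂ _+_ (sym 1+b≡n) (sym 1+b≡n) ⟩
      1 + b + (1 + b) ≤⟨ m≤m+n _ (b + b) ⟩
      1 + b + (1 + b) + (b + b) ≡⟨ ring₂ b ⟩
      4 * b + 2       ∎)
      where
      ring₂ : ∀ b → 1 + b + (1 + b) + (b + b) ≡ 4 * b + 2
      ring₂ = solve-∀
    n≤ : n ≤ 1 + od + indeg
    n≤ = begin
      n                                                                ≡⟨ sym (card-true n) ⟩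
      card {n} (λ _ → true)                                            ≤⟨ sum-mono-≤ pointwise ⟩
      sum (λ i → ind (i ≟ᵇ r) + ind (arcs x r i) + ind (arcs x i r))   ≡⟨ ∑-distrib-+ (λ i → ind (i ≟ᵇ r) + ind (arcs x r i)) _ ⟩
      sum (λ i → ind (i ≟ᵇ r) + ind (arcs x r i)) + indeg              ≡⟨ cong (_+ indeg) (∑-distrib-+ (ind ∘ (_≟ᵇ r)) _) ⟩
      card (_≟ᵇ r) + od + indeg                                        ≡⟨ cong (λ z → z + od + indeg) (card-≟ r) ⟩
      1 + od + indeg                                                   ∎
      where
      pointwise : ∀ i → 1 ≤ ind (i ≟ᵇ r) + ind (arcs x r i) + ind (arcs x i r)
      pointwise i with i Finₚ.≟ r
      ... | yes _  = s≤s z≤n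
      ... | no i≢r with arcs x i r in eq
      ...   | true  = m≤n+m 1 _
      ...   | false rewrite total (tournament x) i r i≢r eq = s≤s z≤n
    indeg≤ : indeg ≤ edges (not ∘ (_≟ᵇ r)) (_≟ᵇ r) x
    indeg≤ = sum-mono-≤ λ i → ≤-trans (≤-reflexive (cong ind (entry i)))
        (term≤sum (λ j → ind ((not (i ≟ᵇ r) ∧ (j ≟ᵇ r)) ∧ arcs x i j)) r)
      where
      entry : ∀ i → arcs x i r ≡ (not (i ≟ᵇ r) ∧ (r ≟ᵇ r)) ∧ arcs x i r
      entry i with i Finₚ.≟ r
      ... | yes refl = irrefl (tournament x) i
      ... | no  _    = cong (_∧ arcs x i r) (sym (dec-true (r Finₚ.≟ r) refl))
    few : suc (c + c) * indeg ≤ suc c * n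
    few = begin
      suc (c + c) * indeg                ≤⟨ *-monoʳ-≤ (suc (c + c)) indeg≤ ⟩
      suc (c + c) * edges (not ∘ (_≟ᵇ r)) (_≟ᵇ r) x ≤⟨ <⇒≤ (not-heavy c′ K (not ∘ (_≟ᵇ r)) (_≟ᵇ r) x light
                                              (subst (threshold c′ K ≤_) (sym b*1≡b) (threshold≤ c′ K MK≤n n≤4b))) ⟩
      suc c * (b * card (_≟ᵇ r))         ≡⟨ cong (suc c *_) b*1≡b ⟩
      suc c * b                          ≤⟨ *-monoʳ-≤ (suc c) (≤-trans (n≤1+n b) (≤-reflexive 1+b≡n)) ⟩
      suc c * n                          ∎
    ring₁ : ∀ c n → c * n + suc c * n ≡ suc (c + c) * n
    ring₁ = solve-∀

  module Lower k .{{_ : NonZero k}} s .{{_ : NonZero s}} (s≡ : s ≡ 4 * k * 2 ^ k) where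

    -- The summands provide, in turn, the exponent for `E₁`, the quadratic growth in `many-pairs`,
    -- and the absolute lower bounds on n in `rich-vertex` and `out-degree`.
    starts : ℕ → ℕ
    starts j = enough s (2 * j) + (s * s * 24 * (2 + 2 * j) + (2 + 2 * 2 ^ k))

    module _ (j n : ℕ) (large : starts j ≤ n) where

      open ≤-Reasoning

      -- The union bound for `E₂` runs over 4^n pairs of subsets, which accounts for n + n; the
      -- remaining 2j covers the factor 2j, as 2j < 2^(2j).
      K₂ : ℕ
      K₂ = n + n + 2 * j

      E₁ : ℕ → Fin n → Code n → Bool
      E₁ K r = Heavy s K (not ∘ (_≟ᵇ r)) (_≟ᵇ r)

      -- The sets that will matter depend on the coloring, so all pairs of subsets are treated in
      -- advance; removing `A` from `B` makes each pair disjoint. The bias parameter 0 means density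
      -- 2/3.
      E₂ : Vec Bool n → Vec Bool n → Code n → Bool
      E₂ A B = Heavy 0 K₂ (lookup A) (λ i → lookup B i ∧ not (lookup A i))

      events : ℕ → List (Code n → Bool)
      events K = List.map (E₁ K) (allFin n) ++ cartesianProductWith E₂ (vecs n) (vecs n)

      large₂ : s * s * 24 * (2 + 2 * j) + (2 + 2 * 2 ^ k) ≤ n
      large₂ = m+n≤o⇒n≤o (enough s (2 * j)) large

      2+2·2^k≤n : 2 + 2 * 2 ^ k ≤ n
      2+2·2^k≤n = m+n≤o⇒n≤o (s * s * 24 * (2 + 2 * j)) large₂

      rare₁ : ∀ K → 2 * j * n ≤ 2 ^ K → 2 * j * occurrences (List.map (E₁ K) (allFin n)) ≤ 2 ^ pairs n
      rare₁ K jn≤ = rare-family K (2 * j) (List.map (E₁ K) (allFin n))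
        (subst (λ l → 2 * j * l ≤ 2 ^ K) (sym (trans (length-map (E₁ K) (allFin n)) (length-tabulate {n = n} (λ i → i)))) jn≤)
        (Allₚ.map⁺ (All.tabulate (λ {r} _ → heavy-rare s K (not ∘ (_≟ᵇ r)) (_≟ᵇ r) (λ i → disjoint (i ≟ᵇ r)))))
        where
        disjoint : ∀ b → not b ∧ b ≡ false
        disjoint true  = refl
        disjoint false = refl

      rare₂ : 2 * j * occurrences (cartesianProductWith E₂ (vecs n) (vecs n)) ≤ 2 ^ pairs n
      rare₂ = rare-family K₂ (2 * j) (cartesianProductWith E₂ (vecs n) (vecs n)) few
        (Allₚ.cartesianProductWith⁺ (setoid _) (setoid _) E₂ (vecs n) (vecs n)
          (λ {A} {B} _ _ → heavy-rare 0 K₂ (lookup A) _ (λ i → disjoint (lookup A i) (lookup B i))))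
        where
        disjoint : ∀ a b → a ∧ (b ∧ not a) ≡ false
        disjoint true  b = ∧-zeroʳ b
        disjoint false b = refl
        few : 2 * j * length (cartesianProductWith E₂ (vecs n) (vecs n)) ≤ 2 ^ K₂
        few = begin
          2 * j * length (cartesianProductWith E₂ (vecs n) (vecs n))
            ≡⟨ cong (2 * j *_) (trans (sym (sumₗ-1 (cartesianProductWith E₂ (vecs n) (vecs n)))) (trans
                 (sumₗ-product E₂ (λ _ → 1) (λ _ → 1) (λ _ → 1) (λ _ _ → refl) (vecs n) (vecs n))
                 (cong₂ _*_ ∣vecs∣ ∣vecs∣))) ⟩
          2 * j * (2 ^ n * 2 ^ n)
            ≤⟨ *-monoˡ-≤ (2 ^ n * 2 ^ n) (<⇒≤ (n<2^n (2 * j))) ⟩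
          2 ^ (2 * j) * (2 ^ n * 2 ^ n)
            ≡⟨ trans (cong (2 ^ (2 * j) *_) (sym (^-distribˡ-+-* 2 n n))) (*-comm (2 ^ (2 * j)) _) ⟩
          2 ^ (n + n) * 2 ^ (2 * j)
            ≡⟨ sym (^-distribˡ-+-* 2 (n + n) (2 * j)) ⟩
          2 ^ K₂ ∎
          where
          ∣vecs∣ : sumₗ (λ _ → 1) (vecs n) ≡ 2 ^ n
          ∣vecs∣ = trans (sumₗ-1 (vecs n)) (length-vecs n)

      -- Each of the two families of events uses up half of the error 1/j.
      rare : ∀ K → 2 * j * n ≤ 2 ^ K → j * occurrences (events K) ≤ 2 ^ pairs n
      rare K jn≤ = *-cancelˡ-≤ 2 (begin
        2 * (j * occurrences (events K))     ≡⟨ cong (λ z → 2 * (j * z)) (sumₗ-++ _ (List.map (E₁ K) (allFin n)) _) ⟩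
        2 * (j * (o₁ + o₂))                  ≡⟨ ring j o₁ o₂ ⟩
        2 * j * o₁ + 2 * j * o₂              ≤⟨ +-mono-≤ (rare₁ K jn≤) rare₂ ⟩
        2 ^ pairs n + 2 ^ pairs n            ≡⟨ cong (2 ^ pairs n +_) (sym (+-identityʳ (2 ^ pairs n))) ⟩
        2 * 2 ^ pairs n                      ∎)
        where
        o₁ = occurrences (List.map (E₁ K) (allFin n))
        o₂ = occurrences (cartesianProductWith E₂ (vecs n) (vecs n))
        ring : ∀ j a b → 2 * (j * (a + b)) ≡ 2 * j * a + 2 * j * b
        ring = solve-∀

      -- The product is at least n²/s², whereas `threshold 0 K₂` is 3 · 8 · `K₂`, linear in n for
      -- fixed `j`; here 8 is `tiltV 0`.
      many-pairs : ∀ {a b} → n ≤ s * a → n ≤ s * b → threshold 0 K₂ ≤ a * b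
      many-pairs {a} {b} n≤sa n≤sb = *-cancelˡ-≤ (s * s) {{m*n≢0 s s}} (begin
        s * s * (3 * (8 * (n + n + 2 * j)))      ≤⟨ *-monoʳ-≤ (s * s) (*-monoʳ-≤ 3 (*-monoʳ-≤ 8 (+-monoʳ-≤ (n + n) (m≤m*n (2 * j) n {{n≢0}})))) ⟩
        s * s * (3 * (8 * (n + n + 2 * j * n)))  ≡⟨ ring₁ (s * s) j n ⟩
        s * s * 24 * (2 + 2 * j) * n             ≤⟨ *-monoˡ-≤ n (m+n≤o⇒m≤o (s * s * 24 * (2 + 2 * j)) large₂) ⟩
        n * n                                    ≤⟨ *-mono-≤ n≤sa n≤sb ⟩
        s * a * (s * b)                          ≡⟨ ring₂ s a b ⟩
        s * s * (a * b)                          ∎)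
        where
        n≢0 : NonZero n
        n≢0 = >-nonZero (≤-trans (s≤s z≤n) 2+2·2^k≤n)
        ring₁ : ∀ x j n → x * (3 * (8 * (n + n + 2 * j * n))) ≡ x * 24 * (2 + 2 * j) * n
        ring₁ = solve-∀
        ring₂ : ∀ s a b → s * a * (s * b) ≡ s * s * (a * b)
        ring₂ = solve-∀

      -- The sets `inTo i v` and `outOf i v` are disjoint because arcs are one-way, so removing the
      -- first from the second in `E₂` changes nothing.
      few-forward : ∀ x → Avoids (cartesianProductWith E₂ (vecs n) (vecs n)) x → (c : Coloring n k) →
        let open Colored x c in ∀ v i → n ≤ s * card (inTo i v) → n ≤ s * card (outOf i v) →
        3 * edges (inTo i v) (outOf i v) x < 2 * (card (inTo i v) * card (outOf i v))
      few-forward x avoids₂ c v i n≤I n≤O = subst₂ (λ e m → 3 * e < 2 * m) (edges-cong x A≡ B≡) cards≡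
        (not-heavy 0 K₂ (lookup A) (λ w → lookup B w ∧ not (lookup A w)) x
          (All.lookup avoids₂ (∈-cartesianProductWith⁺ E₂ (∈-vecs A) (∈-vecs B)))
          (subst (threshold 0 K₂ ≤_) (sym cards≡) (many-pairs n≤I n≤O)))
        where
        open Colored x c
        A = tabulate (inTo i v)
        B = tabulate (outOf i v)
        A≡ : ∀ w → lookup A w ≡ inTo i v w
        A≡ = lookup∘tabulate (inTo i v)
        separate : ∀ w → outOf i v w ∧ not (inTo i v w) ≡ outOf i v w
        separate w with arcs x v w in vw
        ... | false = refl
        ... | true rewrite oneWay (tournament x) v w vw = ∧-identityʳ _
        B≡ : ∀ w → lookup B w ∧ not (lookup A w) ≡ outOf i v w
        B≡ w = trans (cong₂ (λ b a → b ∧ not a) (lookup∘tabulate (outOf i v) w) (A≡ w)) (separate w)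
        cards≡ : card (lookup A) * card (λ w → lookup B w ∧ not (lookup A w)) ≡ card (inTo i v) * card (outOf i v)
        cards≡ = cong₂ _*_ (sum-cong-≗ (cong ind ∘ A≡)) (sum-cong-≗ (cong ind ∘ B≡))

      -- The star at `r` has at least (s + 1)n/(2s + 3) vertices, which is n/2 - n/(4s + 6), and at
      -- least a third of `outOf i v`, so at least n/(3s) vertices, is new. The sum is at least n/2
      -- + n/(12s), since 1/(3s) - 1/(4s) = 1/(12s).
      broom-at : ∀ K → density s * K ≤ n → ∀ x → Avoids (List.map (E₁ K) (allFin n)) x → (c : Coloring n k) →
        let open Colored x c in ∀ v i r → n ≤ s * card (outOf i v) → inTo i v r ≡ true →
        3 * card (λ w → outOf i v w ∧ arcs x r w) < 2 * card (outOf i v) →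
        ∃[ A ] (PathMonochromatic {T = tournament x} c A × DepthAtMost 2 A × (6 * s + 1) * n ≤ 12 * s * size A)
      broom-at K MK≤n x avoids₁ c v i r O-large r∈I few
        = broom , broom-mono c i (∧-elim₂ r∈I) ∧-elim₂ , broom-depth , bound-size
        where
        open Colored x c
        ∧-elim₁ : ∀ {b b′} → b ∧ b′ ≡ true → b ≡ true
        ∧-elim₁ {true} _ = refl
        ∧-elim₂ : ∀ {b} {a a′ : Fin k} → b ∧ (a ≟ᵇ a′) ≡ true → a ≡ a′
        ∧-elim₂ {true} {a} {a′} h with a Finₚ.≟ a′
        ... | yes eq = eq
        open Broom (tournament x) r v (outOf i v) (∧-elim₁ r∈I) ∧-elim₁
        O = outOf i v
        Or : O r ≡ false
        Or = cong (_∧ (c v r ≟ᵇ i)) (oneWay (tournament x) r v (∧-elim₁ r∈I))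
        od = card (arcs x r)
        ex = card (λ w → O w ∧ not (arcs x r w))
        3ex : card O ≤ 3 * ex
        3ex = +-cancelˡ-≤ (2 * card O) _ _ (begin
          2 * card O + card O                              ≡⟨ ring₀ (card O) ⟩
          3 * card O                                       ≡⟨ cong (3 *_) (sym (card-split O (arcs x r))) ⟩
          3 * (card (λ w → O w ∧ arcs x r w) + ex)         ≡⟨ *-distribˡ-+ 3 (card (λ w → O w ∧ arcs x r w)) ex ⟩
          3 * card (λ w → O w ∧ arcs x r w) + 3 * ex       ≤⟨ +-monoˡ-≤ (3 * ex) (<⇒≤ few) ⟩
          2 * card O + 3 * ex                              ∎)
          where
          ring₀ : ∀ a → 2 * a + a ≡ 3 * a
          ring₀ = solve-∀
        n≤3sex : n ≤ s * (3 * ex)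
        n≤3sex = ≤-trans O-large (*-monoʳ-≤ s 3ex)
        s⁺ = suc s
        outdeg : s⁺ * n ≤ suc (s⁺ + s⁺) * (1 + od)
        outdeg = out-degree s K x r (All.lookup avoids₁ (∈-map⁺ (E₁ K) (∈-allFin r))) MK≤n (≤-trans (m≤m+n 2 _) 2+2·2^k≤n)
        bound-size : (6 * s + 1) * n ≤ 12 * s * size broom
        bound-size = *-cancelˡ-≤ (suc (s⁺ + s⁺)) (begin
          suc (s⁺ + s⁺) * ((6 * s + 1) * n)                           ≤⟨ m≤m+n _ (6 * n + 3 * n) ⟩
          suc (s⁺ + s⁺) * ((6 * s + 1) * n) + (6 * n + 3 * n)         ≡⟨ ring₁ s n ⟩
          12 * s * (s⁺ * n) + 4 * suc (s⁺ + s⁺) * n                    ≤⟨ +-mono-≤ (*-monoʳ-≤ (12 * s) outdeg) (*-monoʳ-≤ (4 * suc (s⁺ + s⁺)) n≤3sex) ⟩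
          12 * s * (suc (s⁺ + s⁺) * (1 + od)) + 4 * suc (s⁺ + s⁺) * (s * (3 * ex)) ≡⟨ ring₂ s (suc (s⁺ + s⁺)) od ex ⟩
          suc (s⁺ + s⁺) * (12 * s * (1 + od + ex))                    ≤⟨ *-monoʳ-≤ (suc (s⁺ + s⁺)) (*-monoʳ-≤ (12 * s) (broom-size Or)) ⟩
          suc (s⁺ + s⁺) * (12 * s * size broom)                       ∎)
          where
          ring₁ : ∀ s n → suc (suc s + suc s) * ((6 * s + 1) * n) + (6 * n + 3 * n) ≡ 12 * s * (suc s * n) + 4 * suc (suc s + suc s) * n
          ring₁ = solve-∀
          ring₂ : ∀ s y od ex → 12 * s * (y * (1 + od)) + 4 * y * (s * (3 * ex)) ≡ y * (12 * s * (1 + od + ex))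
          ring₂ = solve-∀

      large-broom : ∀ K → density s * K ≤ n → ∀ x → Avoids (events K) x → (c : Coloring n k) →
        ∃[ A ] (PathMonochromatic {T = tournament x} c A × DepthAtMost 2 A × (6 * s + 1) * n ≤ 12 * s * size A)
      large-broom K MK≤n x avoids c =
        let open Colored x c
            avoids₁ , avoids₂ = Allₚ.++⁻ (List.map (E₁ K) (allFin n)) avoids
            v , i , I-large , O-large = rich-vertex s≡ (≤-trans (n≤1+n _) 2+2·2^k≤n)
            r , r∈I , few = average x (inTo i v) (outOf i v) (few-forward x avoids₂ c v i I-large O-large)
        in broom-at K MK≤n x avoids₁ c v i r O-large r∈I few

      lower : AlmostAll n j (λ T → ∃[ m ] (HasPMA T k 2 m × (6 * s + 1) * n ≤ 12 * s * m))
      lower =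
        let K , MK≤n , jn≤2^K = linear-exponent (density s) {{density≢0 s}} (2 * j) n (m+n≤o⇒m≤o _ large)
            m , X≤Dm , least = ceiling ((6 * s + 1) * n) (12 * s) {{m*n≢0 12 s}}
        in union-bound j (events K) (rare K jn≤2^K) λ x avoids →
          m , (λ c → let A , mono , shallow , big = large-broom K MK≤n x avoids c in A , mono , shallow , least (size A) big) , X≤Dm

open import Data.Rational using (ℚ; _<_; _+_; _*_; ½; 0ℚ; ∣_∣) renaming (_≤_ to _≤ℚ_)
open import Data.Integer as ℤ using (+_; -[1+_]; +[1+_])
import Data.Integer.Properties as ℤₚ
open import Data.Rational as ℚ using (mkℚ; 1ℚ; _/_; toℚᵘ; *<*)
import Data.Rational.Properties as ℚₚ
open import Data.Rational.Unnormalised as ℚᵘ using (mkℚᵘ; *≤*)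
import Data.Rational.Unnormalised.Properties as ℚᵘₚ
open Counting using (AlmostAll; parts; 2≤parts; enough; upper; module Lower)

-- Rational form

-- Unnormalised fractions keep numerators and denominators explicit under sums and products, so that
-- rational inequalities become polynomial ones over ℕ.
_≐_/suc_ : ℚ → ℕ → ℕ → Set
x ≐ a /suc d = toℚᵘ x ℚᵘ.≃ mkℚᵘ (+ a) d

≐-/ : ∀ a d → (+ a / suc d) ≐ a /suc d
≐-/ a d = ℚₚ.toℚᵘ-fromℚᵘ (mkℚᵘ (+ a) d)

≐-+ : ∀ {x y a b d e} → x ≐ a /suc d → y ≐ b /suc e → (x + y) ≐ a ℕ.* suc e ℕ.+ b ℕ.* suc d /suc (e ℕ.+ d ℕ.* suc e)
≐-+ {x} {y} {a} {b} {d} {e} hx hy = ℚᵘₚ.≃-trans (ℚₚ.toℚᵘ-homo-+ x y) (ℚᵘₚ.≃-trans (ℚᵘₚ.+-cong hx hy)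
  (ℚᵘₚ.≃-reflexive (cong (λ z → mkℚᵘ z (e ℕ.+ d ℕ.* suc e))
    (cong₂ ℤ._+_ (sym (ℤₚ.pos-* a (suc e))) (sym (ℤₚ.pos-* b (suc d)))))))

≐-* : ∀ {x y a b d e} → x ≐ a /suc d → y ≐ b /suc e → (x * y) ≐ a ℕ.* b /suc (e ℕ.+ d ℕ.* suc e)
≐-* {x} {y} {a} {b} {d} {e} hx hy = ℚᵘₚ.≃-trans (ℚₚ.toℚᵘ-homo-* x y) (ℚᵘₚ.≃-trans (ℚᵘₚ.*-cong hx hy)
  (ℚᵘₚ.≃-reflexive (cong (λ z → mkℚᵘ z (e ℕ.+ d ℕ.* suc e)) (sym (ℤₚ.pos-* a b)))))

≐-≤ : ∀ {x y a b d e} → x ≐ a /suc d → y ≐ b /suc e → a ℕ.* suc e ≤ b ℕ.* suc d → x ≤ℚ y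
≐-≤ {x} {y} {a} {b} {d} {e} hx hy a/d≤b/e = ℚₚ.toℚᵘ-cancel-≤ (begin
  toℚᵘ x          ≃⟨ hx ⟩
  mkℚᵘ (+ a) d    ≤⟨ *≤* (subst₂ ℤ._≤_ (ℤₚ.pos-* a (suc e)) (ℤₚ.pos-* b (suc d)) (ℤ.+≤+ a/d≤b/e)) ⟩
  mkℚᵘ (+ b) e    ≃⟨ ℚᵘₚ.≃-sym hy ⟩
  toℚᵘ y          ∎)
  where open ℚᵘₚ.≤-Reasoning

positive-≐ : ∀ δ → 0ℚ < δ → ∃[ p ] ∃[ d ] (δ ≐ suc p /suc d)
positive-≐ (mkℚ +[1+ p ] d _) _                = p , d , ℚᵘₚ.≃-refl
positive-≐ (mkℚ (+ 0)    d _) (*<* (ℤ.+<+ ()))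
positive-≐ (mkℚ -[1+ _ ] d _) (*<* ())

almostAll-map : ∀ {n} j {P Q : Tournament n → Set} → (∀ {T} → P T → Q T) → AlmostAll n j P → AlmostAll n j Q
almostAll-map j P⇒Q (L , distinct , ps , len) = L , distinct , All.map P⇒Q ps , len

-- A positive δ is at least 1/(d + 1) for some `d`, so failure probability 1/(c + 1) with `d ≤ c`
-- suffices. Letting `c` depend on `n` admits a precision that improves with `n`.
whp : ∀ {P : ∀ n → Tournament n → Set} →
  (∀ d → ∃[ N ] ∀ n → N ≤ n → ∃[ c ] (d ≤ c × AlmostAll n (suc c) (P n))) → WHP P
whp {P} almost δ 0<δ
  with p , d , δ≐ ← positive-≐ δ 0<δ
  with N , from-N ← almost d
  = N , λ n N≤n → convert n (from-N n N≤n)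
  where
  convert : ∀ n → ∃[ c ] (_ ≤ c × AlmostAll n (suc c) (P n)) → _
  convert n (c , d≤c , L , distinct , ps , len) = L , distinct , ps , (begin
    (1ℚ ℚ.- δ) * ℚ[ X ]            ≤⟨ ℚₚ.*-monoʳ-≤-nonNeg ℚ[ X ] {{ℚₚ.normalize-nonNeg X 1}} 1-δ≤ ⟩
    (+ c / suc c) * ℚ[ X ]         ≤⟨ ≐-≤ (≐-* (≐-/ c c) (≐-/ X 0)) (≐-/ ℓ 0) cX≤ ⟩
    ℚ[ ℓ ]                         ∎)
    where
    open ℚₚ.≤-Reasoning
    X = 2 ℕ.^ (n C 2)
    ℓ = length L
    1≤ : 1ℚ ≤ℚ (+ c / suc c) + δ
    1≤ = ≐-≤ (≐-/ 1 0) (≐-+ (≐-/ c c) δ≐) (ℕr.begin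
      1 ℕ.* suc (d ℕ.+ c ℕ.* suc d)              ℕr.≡⟨ ring c d ⟩
      c ℕ.* suc d ℕ.+ suc d                      ℕr.≤⟨ ℕₚ.+-monoʳ-≤ (c ℕ.* suc d) (ℕₚ.≤-trans (s≤s d≤c) (ℕₚ.m≤m+n (suc c) (p ℕ.* suc c))) ⟩
      c ℕ.* suc d ℕ.+ suc p ℕ.* suc c            ℕr.≡⟨ sym (ℕₚ.*-identityʳ _) ⟩
      (c ℕ.* suc d ℕ.+ suc p ℕ.* suc c) ℕ.* 1    ℕr.∎)
      where
      module ℕr = ℕₚ.≤-Reasoning
      ring : ∀ c d → 1 ℕ.* suc (d ℕ.+ c ℕ.* suc d) ≡ c ℕ.* suc d ℕ.+ suc d
      ring = solve-∀
    1-δ≤ : 1ℚ ℚ.- δ ≤ℚ + c / suc c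
    1-δ≤ = begin
      1ℚ ℚ.- δ                        ≤⟨ ℚₚ.+-monoˡ-≤ (ℚ.- δ) 1≤ ⟩
      (+ c / suc c) + δ ℚ.- δ         ≡⟨ ℚₚ.+-assoc (+ c / suc c) δ (ℚ.- δ) ⟩
      (+ c / suc c) + (δ ℚ.- δ)       ≡⟨ cong ((+ c / suc c) ℚ.+_) (ℚₚ.+-inverseʳ δ) ⟩
      (+ c / suc c) + 0ℚ              ≡⟨ ℚₚ.+-identityʳ (+ c / suc c) ⟩
      + c / suc c                     ∎
    cX≤ : c ℕ.* X ℕ.* 1 ≤ ℓ ℕ.* suc (c ℕ.* 1)
    cX≤ = subst₂ _≤_ (sym (ℕₚ.*-identityʳ (c ℕ.* X))) (ring ℓ c)
      (ℕₚ.+-cancelˡ-≤ X _ _ (ℕₚ.≤-trans len (ℕₚ.≤-reflexive (ℕₚ.+-comm (suc c ℕ.* ℓ) X))))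
      where
      ring : ∀ ℓ c → suc c ℕ.* ℓ ≡ ℓ ℕ.* suc (c ℕ.* 1)
      ring = solve-∀

-- A precision that grows slowly with the number of vertices.

module Diagonal (f : ℕ → ℕ) where

  -- The value rises by one only when `f` of the next value is already within reach. No monotonicity
  -- of `f` is assumed.
  diag : ℕ → ℕ
  diag zero = 0
  diag (suc n) with f (suc (diag n)) ℕ.≤? suc n
  ... | yes _ = suc (diag n)
  ... | no  _ = diag n

  diag-inv : ∀ n → diag n ≡ 0 ⊎ f (diag n) ≤ n
  diag-inv zero = inj₁ refl
  diag-inv (suc n) with f (suc (diag n)) ℕ.≤? suc n
  ... | yes f≤ = inj₂ f≤
  ... | no  _ with diag-inv n
  ...   | inj₁ z  = inj₁ z
  ...   | inj₂ f≤ = inj₂ (ℕₚ.m≤n⇒m≤1+n f≤)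

  -- The initial value 0 is never tested against `f`, hence the separate condition on `f 0`.
  f-diag : ∀ n → f 0 ≤ n → f (diag n) ≤ n
  f-diag n f0≤n with diag-inv n
  ... | inj₁ z  = subst (λ i → f i ≤ n) (sym z) f0≤n
  ... | inj₂ f≤ = f≤

  -- Once `diag n` is at least `i` and `f (suc i) ≤ n`, a step that stays put cannot start from the
  -- value `i`, so afterwards the value exceeds `i` in any case.
  diag-unbounded : ∀ i → ∃[ N ] ∀ n → N ≤ n → i ≤ diag n
  diag-unbounded zero = 0 , λ _ _ → z≤n
  diag-unbounded (suc i) with N , from-N ← diag-unbounded i = suc (N ℕ.+ f (suc i)) , step
    where
    step : ∀ n → suc (N ℕ.+ f (suc i)) ≤ n → suc i ≤ diag n
    step (suc n) (s≤s N+f≤n) with f (suc (diag n)) ℕ.≤? suc n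
    ... | yes _ = s≤s (from-N n (ℕₚ.m+n≤o⇒m≤o N N+f≤n))
    ... | no f≰ = ℕₚ.≤∧≢⇒< (from-N n (ℕₚ.m+n≤o⇒m≤o N N+f≤n))
      λ { refl → f≰ (ℕₚ.m≤n⇒m≤1+n (ℕₚ.m+n≤o⇒n≤o N N+f≤n)) }

-- All three cases equal 1/2 + 1/D with D = `2 * parts k`, because both `parts` and the denominators
-- triple when `k` grows by 3. The fraction (D + 2)/(2D) is written in the form that `≐-+` produces.
bound-≐ : ∀ k → bound (3 ℕ.+ k) ≐ 1 ℕ.* (2 ℕ.* parts k) ℕ.+ 1 ℕ.* 2 /suc (ℕ.pred (2 ℕ.* parts k) ℕ.+ 1 ℕ.* (2 ℕ.* parts k))
bound-≐ k = subst₂ (λ r q → boundCase r q ≐ 1 ℕ.* (2 ℕ.* parts k) ℕ.+ 1 ℕ.* 2 /suc (ℕ.pred (2 ℕ.* parts k) ℕ.+ 1 ℕ.* (2 ℕ.* parts k)))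
    (sym (%-step k)) (sym (/-step k))
  (subst (λ D → boundCase (k ℕ.% 3) (suc (k ℕ./ 3)) ≐ 1 ℕ.* D ℕ.+ 1 ℕ.* 2 /suc (ℕ.pred D ℕ.+ 1 ℕ.* D)) (sym (parts≡ k))
    (case-≐ (k ℕ.% 3) (k ℕ./ 3)))
  where
  denominator : ℕ → ℕ → ℕ
  denominator 0 q = 4 ℕ.* 3 ℕ.^ q
  denominator 1 q = 2 ℕ.* 3 ℕ.^ suc q
  denominator (suc (suc _)) q = 8 ℕ.* 3 ℕ.^ q
  %-step : ∀ k → (3 ℕ.+ k) ℕ.% 3 ≡ k ℕ.% 3
  %-step k = trans (cong (ℕ._% 3) (ℕₚ.+-comm 3 k)) (DivMod.[m+n]%n≡m%n k 3)
  /-step : ∀ k → (3 ℕ.+ k) ℕ./ 3 ≡ suc (k ℕ./ 3)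
  /-step k = DivMod.m/n≡1+[m∸n]/n (ℕₚ.m≤m+n 3 k)
  swap : ∀ a x → 3 ℕ.* (a ℕ.* x) ≡ a ℕ.* (3 ℕ.* x)
  swap = solve-∀
  triple : ∀ r q → 3 ℕ.* denominator r q ≡ denominator r (suc q)
  triple 0 q = swap 4 (3 ℕ.^ q)
  triple 1 q = swap 2 (3 ℕ.^ suc q)
  triple (suc (suc _)) q = swap 8 (3 ℕ.^ q)
  parts≡ : ∀ k → 2 ℕ.* parts k ≡ denominator (k ℕ.% 3) (k ℕ./ 3)
  parts≡ 0 = refl
  parts≡ 1 = refl
  parts≡ 2 = refl
  parts≡ (suc (suc (suc k))) = trans (sym (swap 2 (parts k))) (trans (cong (3 ℕ.*_) (parts≡ k))
    (trans (triple (k ℕ.% 3) (k ℕ./ 3)) (sym (cong₂ denominator (%-step k) (/-step k)))))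
  half+ : ∀ D .{{nz : NonZero D}} → (½ + _/_ (+ 1) D {{nz}}) ≐ 1 ℕ.* D ℕ.+ 1 ℕ.* 2 /suc (ℕ.pred D ℕ.+ 1 ℕ.* D)
  half+ (suc d) = ≐-+ {½} (ℚᵘₚ.≃-refl) (≐-/ 1 d)
  case-≐ : ∀ r q → boundCase r (suc q) ≐ 1 ℕ.* denominator r q ℕ.+ 1 ℕ.* 2 /suc (ℕ.pred (denominator r q) ℕ.+ 1 ℕ.* denominator r q)
  case-≐ 0 q = half+ (4 ℕ.* 3 ℕ.^ q) {{ℕₚ.m*n≢0 4 (3 ℕ.^ q) {{_}} {{ℕₚ.m^n≢0 3 q}}}}
  case-≐ 1 q = half+ (2 ℕ.* 3 ℕ.^ suc q) {{ℕₚ.m*n≢0 2 (3 ℕ.^ suc q) {{_}} {{ℕₚ.m^n≢0 3 (suc q)}}}}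
  case-≐ (suc (suc _)) q = half+ (8 ℕ.* 3 ℕ.^ q) {{ℕₚ.m*n≢0 8 (3 ℕ.^ q) {{_}} {{ℕₚ.m^n≢0 3 q}}}}

upper-ratio : ∀ k c′ n m → 2 ℕ.* parts k ℕ.* suc c′ ℕ.* m ≤ (parts k ℕ.* suc c′ ℕ.+ suc c′ ℕ.+ 2 ℕ.* parts k) ℕ.* n →
  ℚ[ m ] ≤ℚ (bound (3 ℕ.+ k) + + 1 / suc c′) * ℚ[ n ]
upper-ratio k c′ n m h = ≐-≤ (≐-/ m 0) (≐-* (≐-+ (bound-≐ k) (≐-/ 1 c′)) (≐-/ n 0)) (ratio (2 ℕ.* t) refl)
  where
  open ℕₚ.≤-Reasoning
  t = parts k
  c = suc c′
  -- A variable `D` can be split into cases, so that `ℕ.pred D` reduces; `2 * t` itself is not a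
  -- successor by computation.
  ratio : ∀ D → D ≡ 2 ℕ.* t → let e = ℕ.pred D ℕ.+ 1 ℕ.* D in
    m ℕ.* suc (0 ℕ.+ (c′ ℕ.+ e ℕ.* c) ℕ.* 1) ≤ (((1 ℕ.* D ℕ.+ 1 ℕ.* 2) ℕ.* c ℕ.+ 1 ℕ.* suc e) ℕ.* n) ℕ.* 1
  ratio zero    D≡ = contradiction (ℕₚ.≤-trans (ℕₚ.≤-trans (2≤parts k) (ℕₚ.m≤m+n t _)) (ℕₚ.≤-reflexive (sym D≡))) λ ()
  ratio (suc d) D≡ = begin
    m ℕ.* suc (0 ℕ.+ (c′ ℕ.+ (d ℕ.+ 1 ℕ.* suc d) ℕ.* c) ℕ.* 1)   ≡⟨ lhs m c′ d ⟩
    2 ℕ.* (suc d ℕ.* c ℕ.* m)                                      ≡⟨ cong (λ z → 2 ℕ.* (z ℕ.* c ℕ.* m)) D≡ ⟩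
    2 ℕ.* (2 ℕ.* t ℕ.* c ℕ.* m)                                    ≤⟨ ℕₚ.*-monoʳ-≤ 2 h ⟩
    2 ℕ.* ((t ℕ.* c ℕ.+ c ℕ.+ 2 ℕ.* t) ℕ.* n)                     ≡⟨ mid t c n ⟩
    ((2 ℕ.* t ℕ.+ 2) ℕ.* c ℕ.+ 2 ℕ.* (2 ℕ.* t)) ℕ.* n             ≡⟨ cong (λ z → ((z ℕ.+ 2) ℕ.* c ℕ.+ 2 ℕ.* z) ℕ.* n) (sym D≡) ⟩
    ((suc d ℕ.+ 2) ℕ.* c ℕ.+ 2 ℕ.* suc d) ℕ.* n                    ≡⟨ rhs c d n ⟩
    (((1 ℕ.* suc d ℕ.+ 1 ℕ.* 2) ℕ.* c ℕ.+ 1 ℕ.* suc (d ℕ.+ 1 ℕ.* suc d)) ℕ.* n) ℕ.* 1 ∎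
    where
    lhs : ∀ m c′ d → m ℕ.* suc (0 ℕ.+ (c′ ℕ.+ (d ℕ.+ 1 ℕ.* suc d) ℕ.* suc c′) ℕ.* 1) ≡ 2 ℕ.* (suc d ℕ.* suc c′ ℕ.* m)
    lhs = solve-∀
    mid : ∀ t c n → 2 ℕ.* ((t ℕ.* c ℕ.+ c ℕ.+ 2 ℕ.* t) ℕ.* n) ≡ ((2 ℕ.* t ℕ.+ 2) ℕ.* c ℕ.+ 2 ℕ.* (2 ℕ.* t)) ℕ.* n
    mid = solve-∀
    rhs : ∀ c d n → ((suc d ℕ.+ 2) ℕ.* c ℕ.+ 2 ℕ.* suc d) ℕ.* n ≡
      (((1 ℕ.* suc d ℕ.+ 1 ℕ.* 2) ℕ.* c ℕ.+ 1 ℕ.* suc (d ℕ.+ 1 ℕ.* suc d)) ℕ.* n) ℕ.* 1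
    rhs = solve-∀

-- The denominator of the first fraction is 12 s.
lower-ratio : ∀ s .{{_ : NonZero s}} n m → (6 ℕ.* s ℕ.+ 1) ℕ.* n ≤ 12 ℕ.* s ℕ.* m →
  (+ 1 / suc (11 ℕ.+ 12 ℕ.* ℕ.pred s) + ½) * ℚ[ n ] ≤ℚ ℚ[ m ]
lower-ratio (suc s′) n m h = ≐-≤ (≐-* (≐-+ {y = ½} (≐-/ 1 (11 ℕ.+ 12 ℕ.* s′)) ℚᵘₚ.≃-refl) (≐-/ n 0)) (≐-/ m 0)
  (subst₂ _≤_ (lhs s′ n) (rhs s′ m) (ℕₚ.*-monoʳ-≤ 2 h))
  where
  lhs : ∀ s n → 2 ℕ.* ((6 ℕ.* suc s ℕ.+ 1) ℕ.* n) ≡ (1 ℕ.* 2 ℕ.+ 1 ℕ.* suc (11 ℕ.+ 12 ℕ.* s)) ℕ.* n ℕ.* 1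
  lhs = solve-∀
  rhs : ∀ s m → 2 ℕ.* (12 ℕ.* suc s ℕ.* m) ≡ m ℕ.* suc (0 ℕ.+ (1 ℕ.+ (11 ℕ.+ 12 ℕ.* s) ℕ.* 2) ℕ.* 1)
  rhs = solve-∀

-- Passage to high probability.

lower-whp : ∀ k .{{_ : NonZero k}} s .{{_ : NonZero s}} → s ≡ 4 ℕ.* k ℕ.* 2 ℕ.^ k →
  WHP (λ n T → ∃[ m ] (HasPMA T k 2 m × (+ 1 / suc (11 ℕ.+ 12 ℕ.* ℕ.pred s) + ½) * ℚ[ n ] ≤ℚ ℚ[ m ]))
lower-whp k s s≡ = whp λ d → Lower.starts k s s≡ (suc d) , λ n large → d , ℕₚ.≤-refl ,
  almostAll-map (suc d) (λ { (m , has , h) → m , has , lower-ratio s n m h }) (Lower.lower k s s≡ (suc d) n large)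

-- At precision `i`, both the excess over the bound and the failure probability are 1/(i + 1); this
-- is the number of vertices from which `upper` applies.
upper-start : ℕ → ℕ
upper-start i = enough i (suc i) ℕ.+ (suc i ℕ.+ 4)

open Diagonal upper-start

error-term : ℕ → ℚ
error-term n = + 1 / suc (diag n)

error-term→0 : (δ : ℚ) → 0ℚ < δ → ∃[ N ] ((n : ℕ) → N ≤ n → ∣ error-term n ∣ ≤ℚ δ)
error-term→0 δ 0<δ =
  let p , d , δ≐ = positive-≐ δ 0<δ
      N , from-N = diag-unbounded d
  in N , λ n N≤n → subst (_≤ℚ δ)
    (sym (ℚₚ.0≤p⇒∣p∣≡p (ℚₚ.nonNegative⁻¹ (error-term n) {{ℚₚ.normalize-nonNeg 1 (suc (diag n))}})))
    (≐-≤ (≐-/ 1 (diag n)) δ≐ (ℕₚ.≤-trans (ℕₚ.≤-reflexive (ℕₚ.*-identityˡ (suc d)))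
      (ℕₚ.≤-trans (s≤s (from-N n N≤n)) (ℕₚ.m≤m+n (suc (diag n)) (p ℕ.* suc (diag n))))))

upper-whp : ∀ k → WHP (λ n T → (m : ℕ) → HasPMA∞ T (3 ℕ.+ k) m → ℚ[ m ] ≤ℚ (bound (3 ℕ.+ k) + error-term n) * ℚ[ n ])
upper-whp k = whp λ d → let N , from-N = diag-unbounded d in
  N ℕ.+ upper-start 0 , λ n large → diag n , from-N n (ℕₚ.m+n≤o⇒m≤o N large) ,
    almostAll-map (suc (diag n)) (λ h m has → upper-ratio k (diag n) n m (h m has))
      (upper k (diag n) (suc (diag n)) n (f-diag n (ℕₚ.m+n≤o⇒n≤o N large)))

theorem2 : (k : ℕ) → 3 ≤ k →
    (Σ ℚ λ c → 0ℚ < c × WHP (λ n T → ∃[ m ] (HasPMA T k 2 m × (c + ½) * ℚ[ n ] ≤ℚ ℚ[ m ])))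
    × (Σ (ℕ → ℚ) λ ε → ((δ : ℚ) → 0ℚ < δ → ∃[ N ] ((n : ℕ) → N ≤ n → ∣ ε n ∣ ≤ℚ δ))
    × WHP (λ n T → (m : ℕ) → HasPMA∞ T k m → ℚ[ m ] ≤ℚ (bound k + ε n) * ℚ[ n ]))
theorem2 (suc (suc (suc k))) (s≤s (s≤s (s≤s z≤n))) =
    (+ 1 / suc d₀ , ℚₚ.positive⁻¹ (+ 1 / suc d₀) {{ℚₚ.normalize-pos 1 (suc d₀)}} , lower-whp (3 ℕ.+ k) s {{s≢0}} refl)
  , (error-term , error-term→0 , upper-whp k)
  where
  s d₀ : ℕ
  s = 4 ℕ.* (3 ℕ.+ k) ℕ.* 2 ℕ.^ (3 ℕ.+ k)
  d₀ = 11 ℕ.+ 12 ℕ.* ℕ.pred s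
  s≢0 : NonZero s
  s≢0 = ℕₚ.m*n≢0 (4 ℕ.* (3 ℕ.+ k)) (2 ℕ.^ (3 ℕ.+ k)) {{_}} {{ℕₚ.m^n≢0 2 (3 ℕ.+ k)}}
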